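{- For every nonnegative integer $n$, $a(25n+22)\equiv 0 \pmod 5$.
   Context: Let $(q;q)_\infty=\prod_{n=1}^\infty(1-q^n)$ and $(q^2;q^2)_\infty=\prod_{n=1}^\infty(1-q^{2n})$. The number of cubic partitions $a(n)$ is defined for $n\ge 0$ by the generating function $\sum_{n=0}^\infty a(n)q^n=\frac{1}{(q;q)_\infty(q^2;q^2)_\infty}$; equivalently, $a(n)$ is the number of pairs of partitions $(\lambda,\mu)$ with $|\lambda|+|\mu|=n$ and all parts of $\mu$ even. -}

module Defs where

open import Data.Nat using (ℕ; zero; suc; _+_; _*_; _∸_; _<ᵇ_)
open import Data.Bool using (if_then_else_)

Series : Set
Series = ℕ → ℕ

one : Series
one zero    = 1
one (suc _) = 0

-- Multiplication of a series f by 1/(1 - q^m) = Σ_j q^{m j}, for m ≥ 1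
-- (we take m = suc k).  Coefficient of q^n in f/(1-q^{k+1}) is
-- Σ_{j, (k+1) j ≤ n} f(n - (k+1) j); computed with fuel n.
divGeom : ℕ → Series → Series
divGeom k f n = go n n
  where
  m = suc k
  go : ℕ → ℕ → ℕ
  go zero    r = f r
  go (suc t) r = f r + (if r <ᵇ m then 0 else go t (r ∸ m))

-- 1 / Π_{i=1}^{N} (1 - q^{s i}) as a series, where s i = i (step 1) or 2 i (step 2).
-- invProd c N = Π_{i=1}^{N} 1/(1 - q^{c i}) for c ≥ 1 given as c = suc c'.
invProd : ℕ → ℕ → Series
invProd c' zero    = one
invProd c' (suc N) = divGeom (suc c' * suc N ∸ 1) (invProd c' N)

-- Truncation of 1/((q;q)_∞ (q²;q²)_∞) to the factors with index ≤ N.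
-- Factors (1 - q^i), (1 - q^{2i}) with i > n do not affect the coefficient of q^n,
-- so taking N = n gives the exact coefficient.
cubicSeries : ℕ → Series
cubicSeries N = divGeom0 (invProd 0 N)
  where
  divGeom0 : Series → Series
  divGeom0 f = invProdOn N f
    where
    invProdOn : ℕ → Series → Series
    invProdOn zero    g = g
    invProdOn (suc M) g = divGeom (2 * suc M ∸ 1) (invProdOn M g)

-- a(n): the number of cubic partitions of n, i.e. the coefficient of q^n in
-- 1/((q;q)_∞ (q²;q²)_∞).
a : ℕ → ℕ
a n = cubicSeries n n

{-# OPTIONS --safe #-}

-- Write E(q) = (q;q)_∞ and A(q) = Σ a(n) q^n = 1/(E(q) E(q²)), and let U_r extract the coefficients of q^{5n+r}.
-- Jacobi's J = Σ (-1)^k (2k+1) q^{k(k+1)/2} = E(q)³ and Gauss's ψ = Σ q^{k(k+1)/2} = E(q²)²/E(q) both follow from a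
-- finite triple product, and E^5 ≡ E(q^5) mod 5 gives
--   A(q) E(q^5) E(q^10) ≡ (E(q) E(q²))⁴ = F,   F = J² ψ² = Σ v₁ v₂ q^{(|v|² - 4)/8}  over v ∈ (1 + 4ℤ)⁴.
-- Multiplication by 1 + 2i on pairs of coordinates yields three identities between the sums m_i = Σ x^i q^{(x² - 1)/8}
-- over x ≡ 1 mod 4, taken modulo 5. Splitting J and ψ by exponents modulo 5, these say that U_2 F ≡ 3 F, a Hecke
-- relation at the prime 5. Hence U_2 A ≡ 3 J(q) J(q²). The exponents of J with nonzero coefficient modulo 5 are
-- ≡ 0 or 1, so those of J(q) J(q²) are ≡ 0, 1, 2 or 3, and U_4 U_2 A ≡ 0.
module Submission where

open import Defs
open import Algebra.Bundles using (CommutativeRing; RawRing)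
open import Algebra.Solver.Ring.AlmostCommutativeRing using (AlmostCommutativeRing; fromCommutativeRing; _-Raw-AlmostCommutative⟶_; Induced-equivalence)
open import Algebra.Structures using (IsCommutativeRing)
open import Data.Bool using (if_then_else_; true; false)
open import Data.Empty using (⊥-elim)
open import Data.Integer as ℤ using (ℤ; +_; -[1+_]; 0ℤ; 1ℤ)
import Data.Integer.Properties as ℤ
open import Data.Integer.Divisibility.Signed as ∣ using (divides; _∣?_)
open import Data.Integer.Tactic.RingSolver using (solve-∀)
open import Data.List using (List; []; _∷_)
import Data.Maybe as Maybe
open import Data.Nat using (ℕ; zero; suc; _+_; _*_; _∸_; _≤_; _<_; z≤n; s≤s; s≤s⁻¹; _<ᵇ_; _≤?_; _<?_; _%_; _/_)
import Data.Nat.DivMod as ℕ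
import Data.Nat.Properties as ℕ
import Data.Nat.Tactic.RingSolver as ℕ-Solver
open import Data.Nat.Divisibility using (_∣_)
open import Data.Nat.Primality using (Prime; euclidsLemma; prime?)
open import Data.Product using (_×_; _,_; proj₁; proj₂; ∃-syntax)
import Data.Sum as Sum
open import Function using (_∘_; _$_)
open import Level using (0ℓ)
open import Relation.Binary.Definitions using (WeaklyDecidable)
open import Relation.Binary.PropositionalEquality as ≡ using (_≡_; _≢_; refl; cong; cong₂; subst; module ≡-Reasoning)
import Relation.Binary.Reasoning.Setoid as SetoidReasoning
open import Relation.Nullary using (Dec; ¬_; yes; no)
open import Relation.Nullary.Decidable using (dec⇒maybe; from-yes; True; toWitness)

-- Integers modulo 5

-- The residue 2 is forced: (|v|² - 4)/8 ≡ 2 mod 5 exactly when 5 divides |v|². For one pair of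
-- coordinates, (x² + z² - 2)/8 ≡ 1 exactly when 5 divides x² + z², that is z ≡ ±2x, and the pairs
-- with z ≡ 2x are the image of a multiplication by a Gaussian integer of norm 5. Four coordinates
-- need no quaternions, because the part of J² ψ² with exponents ≡ 2 is a quadratic expression in
-- three sums over pairs with z ≡ 2x, weighted by 1, x and xz. Working modulo 5 makes residue
-- conditions algebraic. By Fermat, 1 - y⁴ is the indicator of 5 | y, so a sum restricted to z ≡ 2x
-- is a linear combination of products m_i m_j; and the series supported on one residue class of
-- exponents are the eigenvectors of q d/dq. Infinite products never occur. Every identity is stated
-- to a finite precision, and finite products that are long enough for that precision replace the
-- infinite ones.

infix 4 _∼_

record _∼_ (x y : ℤ) : Set where
  constructor mod5
  field difference : + 5 ∣.∣ (x ℤ.- y)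

∼-reflexive : ∀ {x y} → x ≡ y → x ∼ y
∼-reflexive {x} refl = mod5 (divides 0ℤ (ℤ.+-inverseʳ x))

∼-refl : ∀ {x} → x ∼ x
∼-refl = ∼-reflexive refl

-- With the quotient as explicit witness, a congruence becomes a polynomial identity over ℤ, which
-- the ring solver decides.
by-quotient : ∀ {x y} q → x ≡ y ℤ.+ q ℤ.* + 5 → x ∼ y
by-quotient {y = y} q refl = mod5 (divides q (lem y q))
  where
  lem : ∀ y q → y ℤ.+ q ℤ.* + 5 ℤ.- y ≡ q ℤ.* + 5
  lem = solve-∀

∼-sym : ∀ {x y} → x ∼ y → y ∼ x
∼-sym {x} {y} (mod5 p) = mod5 $ subst (+ 5 ∣.∣_) (lem x y) (∣.∣m⇒∣-m p)
  where
  lem : ∀ x y → ℤ.- (x ℤ.- y) ≡ y ℤ.- x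
  lem = solve-∀

∼-trans : ∀ {x y z} → x ∼ y → y ∼ z → x ∼ z
∼-trans {x} {y} {z} (mod5 p) (mod5 q) = mod5 $ subst (+ 5 ∣.∣_) (lem x y z) (∣.∣m∣n⇒∣m+n p q)
  where
  lem : ∀ x y z → (x ℤ.- y) ℤ.+ (y ℤ.- z) ≡ x ℤ.- z
  lem = solve-∀

∼-+ : ∀ {x x′ y y′} → x ∼ x′ → y ∼ y′ → x ℤ.+ y ∼ x′ ℤ.+ y′
∼-+ {x} {x′} {y} {y′} (mod5 p) (mod5 q) = mod5 $ subst (+ 5 ∣.∣_) (lem x x′ y y′) (∣.∣m∣n⇒∣m+n p q)
  where
  lem : ∀ x x′ y y′ → (x ℤ.- x′) ℤ.+ (y ℤ.- y′) ≡ x ℤ.+ y ℤ.- (x′ ℤ.+ y′)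
  lem = solve-∀

∼-* : ∀ {x x′ y y′} → x ∼ x′ → y ∼ y′ → x ℤ.* y ∼ x′ ℤ.* y′
∼-* {x} {x′} {y} {y′} (mod5 p) (mod5 q) =
  mod5 $ subst (+ 5 ∣.∣_) (lem x x′ y y′) (∣.∣m∣n⇒∣m+n (∣.∣n⇒∣m*n x q) (∣.∣n⇒∣m*n y′ p))
  where
  lem : ∀ x x′ y y′ → x ℤ.* (y ℤ.- y′) ℤ.+ y′ ℤ.* (x ℤ.- x′) ≡ x ℤ.* y ℤ.- x′ ℤ.* y′
  lem = solve-∀

∼-neg : ∀ {x y} → x ∼ y → ℤ.- x ∼ ℤ.- y
∼-neg {x} {y} (mod5 p) = mod5 $ subst (+ 5 ∣.∣_) (lem x y) (∣.∣m⇒∣-m p)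
  where
  lem : ∀ x y → ℤ.- (x ℤ.- y) ≡ ℤ.- x ℤ.- ℤ.- y
  lem = solve-∀

fermat : ∀ x → x ℤ.^ 5 ∼ x
fermat (+ n) = nonneg n
  where
  binomial : ∀ x → (1ℤ ℤ.+ x) ℤ.* ((1ℤ ℤ.+ x) ℤ.* ((1ℤ ℤ.+ x) ℤ.* ((1ℤ ℤ.+ x) ℤ.* ((1ℤ ℤ.+ x) ℤ.* 1ℤ))))
    ≡ (1ℤ ℤ.+ x ℤ.* (x ℤ.* (x ℤ.* (x ℤ.* (x ℤ.* 1ℤ)))))
      ℤ.+ (x ℤ.* x ℤ.* x ℤ.* x ℤ.+ + 2 ℤ.* (x ℤ.* x ℤ.* x) ℤ.+ + 2 ℤ.* (x ℤ.* x) ℤ.+ x) ℤ.* + 5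
  binomial = solve-∀
  step : ∀ x → (1ℤ ℤ.+ x) ℤ.^ 5 ∼ 1ℤ ℤ.+ x ℤ.^ 5
  -- The quotient is ((1 + x)^5 - 1 - x^5)/5.
  step x = by-quotient (x ℤ.* x ℤ.* x ℤ.* x ℤ.+ + 2 ℤ.* (x ℤ.* x ℤ.* x) ℤ.+ + 2 ℤ.* (x ℤ.* x) ℤ.+ x) (binomial x)
  nonneg : ∀ n → (+ n) ℤ.^ 5 ∼ + n
  nonneg zero    = ∼-refl
  nonneg (suc n) = ∼-trans (step (+ n)) (∼-+ (∼-refl {1ℤ}) (nonneg n))
fermat -[1+ n ] = ∼-trans (∼-reflexive (odd (+ (suc n)))) (∼-neg (fermat (+ suc n)))
  where
  odd : ∀ x → ℤ.- x ℤ.* (ℤ.- x ℤ.* (ℤ.- x ℤ.* (ℤ.- x ℤ.* (ℤ.- x ℤ.* 1ℤ))))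
    ≡ ℤ.- (x ℤ.* (x ℤ.* (x ℤ.* (x ℤ.* (x ℤ.* 1ℤ)))))
  odd = solve-∀

-- Formal power series

PowerSeries : Set
PowerSeries = ℕ → ℤ

infix  8 -_
infixl 7 _·_
infixl 6 _⊕_ _⊖_
infix  4 _≈[_]_

-- Equality of f and g in 𝔽₅[q]/(q^N).
record _≈[_]_ (f : PowerSeries) (N : ℕ) (g : PowerSeries) : Set where
  constructor agree
  field coeff : ∀ n → n < N → f n ∼ g n
open _≈[_]_ public

tail : PowerSeries → PowerSeries
tail f n = f (suc n)

opaque
  _⊕_ : PowerSeries → PowerSeries → PowerSeries
  (f ⊕ g) n = f n ℤ.+ g n

  -_ : PowerSeries → PowerSeries
  (- f) n = ℤ.- f n

  const : ℤ → PowerSeries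
  const c zero    = c
  const c (suc _) = 0ℤ

  shift : PowerSeries → PowerSeries
  shift f zero    = 0ℤ
  shift f (suc n) = f n

  -- The Cauchy product, by recursion along f = f(0) + q `tail f` instead of a sum over indices; the
  -- ring laws then follow by induction on the exponent.
  _·_ : PowerSeries → PowerSeries → PowerSeries
  (f · g) zero    = f 0 ℤ.* g 0
  (f · g) (suc n) = f 0 ℤ.* g (suc n) ℤ.+ (tail f · g) n

_⊖_ : PowerSeries → PowerSeries → PowerSeries
f ⊖ g = f ⊕ - g

opaque
  unfolding _·_

  zero-·ₙ : ∀ f g → (∀ n → f n ≡ 0ℤ) → ∀ n → (f · g) n ≡ 0ℤ
  zero-·ₙ f g f≡0 zero    = cong (ℤ._* g 0) (f≡0 0)
  zero-·ₙ f g f≡0 (suc n) =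
    cong₂ ℤ._+_ (cong (ℤ._* g (suc n)) (f≡0 0)) (zero-·ₙ (tail f) g (f≡0 ∘ suc) n)

  const-·ₙ : ∀ c f n → (const c · f) n ≡ c ℤ.* f n
  const-·ₙ c f zero    = refl
  const-·ₙ c f (suc n) =
    ≡.trans (cong (λ z → c ℤ.* f (suc n) ℤ.+ z) (zero-·ₙ (tail (const c)) f (λ _ → refl) n)) (ℤ.+-identityʳ _)

  shift-·ₙ : ∀ f g n → (shift f · g) n ≡ shift (f · g) n
  shift-·ₙ f g zero    = refl
  shift-·ₙ f g (suc n) = ℤ.+-identityˡ _

  -- The form required by associativity: `tail (f · g)` is by definition f(0) times `tail g` plus
  -- `tail f · g`.
  linear-·ₙ : ∀ c f g h n → ((λ m → c ℤ.* f m ℤ.+ g m) · h) n ≡ c ℤ.* (f · h) n ℤ.+ (g · h) n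
  linear-·ₙ c f g h zero    = lem c (f 0) (g 0) (h 0)
    where
    lem : ∀ c f g h → (c ℤ.* f ℤ.+ g) ℤ.* h ≡ c ℤ.* (f ℤ.* h) ℤ.+ g ℤ.* h
    lem = solve-∀
  linear-·ₙ c f g h (suc n) =
    ≡.trans (cong (λ z → (c ℤ.* f 0 ℤ.+ g 0) ℤ.* h (suc n) ℤ.+ z) (linear-·ₙ c (tail f) (tail g) h n)) (lem c (f 0) (g 0) (h (suc n)) ((tail f · h) n) ((tail g · h) n))
    where
    lem : ∀ c f g h a b → (c ℤ.* f ℤ.+ g) ℤ.* h ℤ.+ (c ℤ.* a ℤ.+ b) ≡ c ℤ.* (f ℤ.* h ℤ.+ a) ℤ.+ (g ℤ.* h ℤ.+ b)
    lem = solve-∀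

  ·-sucʳₙ : ∀ f g n → (f · g) (suc n) ≡ f (suc n) ℤ.* g 0 ℤ.+ (f · tail g) n
  ·-sucʳₙ f g zero    = ℤ.+-comm (f 0 ℤ.* g 1) _
  ·-sucʳₙ f g (suc n) =
    ≡.trans (cong (λ z → f 0 ℤ.* g (suc (suc n)) ℤ.+ z) (·-sucʳₙ (tail f) g n)) (lem (f 0 ℤ.* g (suc (suc n))) (f (suc (suc n)) ℤ.* g 0) _)
    where
    lem : ∀ a b c → a ℤ.+ (b ℤ.+ c) ≡ b ℤ.+ (a ℤ.+ c)
    lem = solve-∀

  ·-commₙ : ∀ f g n → (f · g) n ≡ (g · f) n
  ·-commₙ f g zero    = ℤ.*-comm (f 0) (g 0)
  ·-commₙ f g (suc n) =
    ≡.trans (cong₂ ℤ._+_ (ℤ.*-comm (f 0) (g (suc n))) (·-commₙ (tail f) g n)) (≡.sym (·-sucʳₙ g f n))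

  ·-assocₙ : ∀ f g h n → ((f · g) · h) n ≡ (f · (g · h)) n
  ·-assocₙ f g h zero    = ℤ.*-assoc (f 0) (g 0) (h 0)
  ·-assocₙ f g h (suc n) =
    ≡.trans (cong (λ z → f 0 ℤ.* g 0 ℤ.* h (suc n) ℤ.+ z) (≡.trans (linear-·ₙ (f 0) (tail g) (tail f · g) h n) (cong (λ z → f 0 ℤ.* (tail g · h) n ℤ.+ z) (·-assocₙ (tail f) g h n))))
      (lem (f 0) (g 0) (h (suc n)) ((tail g · h) n) ((tail f · (g · h)) n))
    where
    lem : ∀ f g h a b → f ℤ.* g ℤ.* h ℤ.+ (f ℤ.* a ℤ.+ b) ≡ f ℤ.* (g ℤ.* h ℤ.+ a) ℤ.+ b
    lem = solve-∀

  ·-distribʳₙ : ∀ h f g n → ((f ⊕ g) · h) n ≡ (f · h) n ℤ.+ (g · h) n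
  ·-distribʳₙ h f g zero    = ℤ.*-distribʳ-+ (h 0) (f 0) (g 0)
  ·-distribʳₙ h f g (suc n) =
    ≡.trans (cong (λ z → (f 0 ℤ.+ g 0) ℤ.* h (suc n) ℤ.+ z) (·-distribʳₙ h (tail f) (tail g) n)) (lem (f 0) (g 0) (h (suc n)) ((tail f · h) n) ((tail g · h) n))
    where
    lem : ∀ f g h a b → (f ℤ.+ g) ℤ.* h ℤ.+ (a ℤ.+ b) ≡ (f ℤ.* h ℤ.+ a) ℤ.+ (g ℤ.* h ℤ.+ b)
    lem = solve-∀

  ·-congₙ : ∀ f f′ g g′ n → (∀ m → m ≤ n → f m ∼ f′ m) → (∀ m → m ≤ n → g m ∼ g′ m) → (f · g) n ∼ (f′ · g′) n
  ·-congₙ f f′ g g′ zero    p q = ∼-* (p 0 z≤n) (q 0 z≤n)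
  ·-congₙ f f′ g g′ (suc n) p q =
    ∼-+ (∼-* (p 0 z≤n) (q (suc n) ℕ.≤-refl))
        (·-congₙ (tail f) (tail f′) g g′ n (λ m m≤n → p (suc m) (s≤s m≤n)) (λ m m≤n → q m (ℕ.m≤n⇒m≤1+n m≤n)))

pointwise : ∀ {f g N} → (∀ n → f n ≡ g n) → f ≈[ N ] g
pointwise p = agree λ n _ → ∼-reflexive (p n)

module _ {N : ℕ} where
  ≈-refl : ∀ {f} → f ≈[ N ] f
  ≈-refl = agree λ _ _ → ∼-refl

  ≈-sym : ∀ {f g} → f ≈[ N ] g → g ≈[ N ] f
  ≈-sym p = agree λ n n<N → ∼-sym (coeff p n n<N)

  ≈-trans : ∀ {f g h} → f ≈[ N ] g → g ≈[ N ] h → f ≈[ N ] h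
  ≈-trans p q = agree λ n n<N → ∼-trans (coeff p n n<N) (coeff q n n<N)

opaque
  unfolding _·_

  series-isCommutativeRing : ∀ N → IsCommutativeRing _≈[ N ]_ _⊕_ _·_ -_ (const 0ℤ) (const 1ℤ)
  series-isCommutativeRing N = record
    { isRing = record
      { +-isAbelianGroup = record
        { isGroup = record
          { isMonoid = record
            { isSemigroup = record
              { isMagma = record
                { isEquivalence = record { refl = ≈-refl ; sym = ≈-sym ; trans = ≈-trans }
                ; ∙-cong = λ p q → agree λ n n<N → ∼-+ (coeff p n n<N) (coeff q n n<N)
                }
              ; assoc = λ f g h → pointwise λ n → ℤ.+-assoc (f n) (g n) (h n)
              }
            ; identity = (λ f → pointwise λ n → ≡.trans (cong (ℤ._+ f n) (const0 n)) (ℤ.+-identityˡ _))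
                       , (λ f → pointwise λ n → ≡.trans (cong (λ z → f n ℤ.+ z) (const0 n)) (ℤ.+-identityʳ _))
            }
          ; inverse = (λ f → pointwise λ n → ≡.trans (ℤ.+-inverseˡ (f n)) (≡.sym (const0 n)))
                    , (λ f → pointwise λ n → ≡.trans (ℤ.+-inverseʳ (f n)) (≡.sym (const0 n)))
          ; ⁻¹-cong = λ p → agree λ n n<N → ∼-neg (coeff p n n<N)
          }
        ; comm = λ f g → pointwise λ n → ℤ.+-comm (f n) (g n)
        }
      ; *-cong = λ {f} {f′} {g} {g′} p q → agree λ n n<N → ·-congₙ f f′ g g′ n
          (λ m m≤n → coeff p m (ℕ.≤-<-trans m≤n n<N)) (λ m m≤n → coeff q m (ℕ.≤-<-trans m≤n n<N))
      ; *-assoc = λ f g h → pointwise (·-assocₙ f g h)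
      ; *-identity = identityˡ , λ f → ≈-trans (pointwise (·-commₙ f _)) (identityˡ f)
      ; distrib = (λ f g h → pointwise λ n → ≡.trans (·-commₙ f (g ⊕ h) n)
                     (≡.trans (·-distribʳₙ f g h n) (cong₂ ℤ._+_ (·-commₙ g f n) (·-commₙ h f n))))
                , (λ f g h → pointwise (·-distribʳₙ f g h))
      }
    ; *-comm = λ f g → pointwise (·-commₙ f g)
    }
    where
    const0 : ∀ n → const 0ℤ n ≡ 0ℤ
    const0 zero    = refl
    const0 (suc n) = refl
    identityˡ : ∀ f → const 1ℤ · f ≈[ N ] f
    identityˡ f = pointwise λ n → ≡.trans (const-·ₙ 1ℤ f n) (ℤ.*-identityˡ (f n))

seriesRing : ℕ → CommutativeRing 0ℓ 0ℓ
seriesRing N = record { isCommutativeRing = series-isCommutativeRing N }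

#_ : ℕ → PowerSeries
# n = const (+ n)

opaque
  unfolding _·_

  const-cong : ∀ {N x y} → x ∼ y → const x ≈[ N ] const y
  const-cong x∼y = agree λ { zero _ → x∼y ; (suc _) _ → ∼-refl }

  const-+ : ∀ {N} x y → const (x ℤ.+ y) ≈[ N ] const x ⊕ const y
  const-+ x y = pointwise λ { zero → refl ; (suc _) → refl }

  const-· : ∀ {N} x y → const (x ℤ.* y) ≈[ N ] const x · const y
  const-· x y = pointwise λ n → ≡.sym (≡.trans (const-·ₙ x (const y) n) (lem n))
    where
    lem : ∀ n → x ℤ.* const y n ≡ const (x ℤ.* y) n
    lem zero    = refl
    lem (suc n) = ℤ.*-zeroʳ x

  const-neg : ∀ {N} x → const (ℤ.- x) ≈[ N ] - const x
  const-neg x = pointwise λ { zero → refl ; (suc _) → refl }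

%5-∼ : ∀ m → + (m % 5) ∼ + m
%5-∼ m = ∼-sym (by-quotient (+ (m / 5)) (≡.trans (cong +_ (ℕ.m≡m%n+[m/n]*n m 5)) (cong (λ z → + (m % 5) ℤ.+ z) (ℤ.pos-* (m / 5) 5))))

-- Coefficients of the ring solver are kept reduced modulo 5, so that it decides identities over 𝔽₅.
𝔽₅ : RawRing 0ℓ 0ℓ
𝔽₅ = record
  { Carrier = ℕ
  ; _≈_     = _≡_
  ; _+_     = λ m n → (m + n) % 5
  ; _*_     = λ m n → (m * n) % 5
  ; -_      = λ m → (4 * m) % 5
  ; 0#      = 0
  ; 1#      = 1
  }

module Solver (N : ℕ) where
  almostCommutativeRing : AlmostCommutativeRing 0ℓ 0ℓ
  almostCommutativeRing = fromCommutativeRing (seriesRing N)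

  #-morphism : 𝔽₅ -Raw-AlmostCommutative⟶ almostCommutativeRing
  #-morphism = record
    { ⟦_⟧    = #_
    ; +-homo = λ m n → ≈-trans (const-cong (%5-∼ (m + n))) (const-+ (+ m) (+ n))
    ; *-homo = λ m n → ≈-trans (const-cong (∼-trans (%5-∼ (m * n)) (∼-reflexive (ℤ.pos-* m n)))) (const-· (+ m) (+ n))
    ; -‿homo = λ m → ≈-trans (const-cong (∼-trans (%5-∼ (4 * m))
                 (by-quotient (+ m) (≡.trans (ℤ.pos-* 4 m) (lem (+ m)))))) (const-neg (+ m))
    ; 0-homo = ≈-refl
    ; 1-homo = ≈-refl
    }
    where
    lem : ∀ x → + 4 ℤ.* x ≡ ℤ.- x ℤ.+ x ℤ.* + 5
    lem = solve-∀

  _≟#_ : WeaklyDecidable (Induced-equivalence #-morphism)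
  m ≟# n = Maybe.map (λ { refl → ≈-refl {N} {# m} }) (dec⇒maybe (m ℕ.≟ n))

  open import Algebra.Solver.Ring 𝔽₅ almostCommutativeRing #-morphism _≟#_ public
    using (solve; con; _:=_; _:+_; _:*_; _:-_; :-_)

module SeriesEq {N : ℕ} = CommutativeRing (seriesRing N)
open SeriesEq using () renaming (+-cong to ⊕-cong; *-cong to ·-cong; -‿cong to neg-cong; *-comm to ·-comm; *-assoc to ·-assoc; *-identityˡ to ·-identityˡ; zeroˡ to ·-zeroˡ; zeroʳ to ·-zeroʳ; +-identityʳ to ⊕-identityʳ; +-identityˡ to ⊕-identityˡ)

module ≈-Reasoning (N : ℕ) = SetoidReasoning (CommutativeRing.setoid (seriesRing N))

·-congˡ : ∀ {N f g h} → g ≈[ N ] h → f · g ≈[ N ] f · h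
·-congˡ = ·-cong ≈-refl

·-congʳ : ∀ {N f g h} → g ≈[ N ] h → g · f ≈[ N ] h · f
·-congʳ p = ·-cong p ≈-refl

weaken : ∀ {M N f g} → M ≤ N → f ≈[ N ] g → f ≈[ M ] g
weaken M≤N p = agree λ n n<M → coeff p n (ℕ.<-≤-trans n<M M≤N)

≈-zero : ∀ {f g} → f ≈[ 0 ] g
≈-zero = agree λ n ()

-- Powers of q

infix 9 q^_

opaque
  unfolding _·_

  q^_ : ℕ → PowerSeries
  q^ zero  = const 1ℤ
  q^ suc n = shift (q^ n)

  q^0 : q^ 0 ≡ # 1
  q^0 = refl

  shift-cong : ∀ {N f g} → f ≈[ N ] g → shift f ≈[ suc N ] shift g
  shift-cong p = agree λ { zero _ → ∼-refl ; (suc n) n<N → coeff p n (s≤s⁻¹ n<N) }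

  q^suc-· : ∀ {N} k f → q^ suc k · f ≈[ N ] shift (q^ k · f)
  q^suc-· k f = pointwise (shift-·ₙ (q^ k) f)

  -- A positive power of q gains a term of precision. Splitting a series by `head+tail` therefore
  -- allows induction on the precision, the method used below for `dilate-·`, `frobenius`, `leibniz`
  -- and others.
  raise : ∀ {N f g} k → f ≈[ N ] g → q^ suc k · f ≈[ suc N ] q^ suc k · g
  raise k p = ≈-trans (q^suc-· k _) (≈-trans (shift-cong (·-congˡ p)) (≈-sym (q^suc-· k _)))

  q^-+ : ∀ {N} m n → q^ (m + n) ≈[ N ] q^ m · q^ n
  q^-+ zero    n = ≈-sym (·-identityˡ _)
  q^-+ (suc m) n = ≈-sym (≈-trans (q^suc-· m _) (weaken (ℕ.n≤1+n _) (shift-cong (≈-sym (q^-+ m n)))))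

  q^-<ₙ : ∀ k {n} → n < k → (q^ k) n ≡ 0ℤ
  q^-<ₙ (suc k) {zero}  _   = refl
  q^-<ₙ (suc k) {suc n} n<k = q^-<ₙ k (s≤s⁻¹ n<k)

  q^≈0 : ∀ {N k} → N ≤ k → q^ k ≈[ N ] # 0
  q^≈0 {k = k} N≤k = agree λ n n<N → ∼-reflexive (≡.trans (q^-<ₙ k (ℕ.<-≤-trans n<N N≤k)) (const0 n))
    where
    const0 : ∀ n → 0ℤ ≡ const 0ℤ n
    const0 zero    = refl
    const0 (suc _) = refl

  q^-·-< : ∀ k f {n} → n < k → (q^ k · f) n ≡ 0ℤ
  q^-·-< (suc k) f {zero}  _   = refl
  q^-·-< (suc k) f {suc n} n<k = ≡.trans (shift-·ₙ (q^ k) f (suc n)) (q^-·-< k f (s≤s⁻¹ n<k))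

  q^-·-+ : ∀ k f n → (q^ k · f) (k + n) ≡ f n
  q^-·-+ zero    f n = ≡.trans (const-·ₙ 1ℤ f n) (ℤ.*-identityˡ _)
  q^-·-+ (suc k) f n = ≡.trans (shift-·ₙ (q^ k) f (suc (k + n))) (q^-·-+ k f n)

  head+tail : ∀ {N} f → f ≈[ N ] const (f 0) ⊕ q^ 1 · tail f
  head+tail f = pointwise λ where
    zero    → ≡.sym (≡.trans (cong (λ z → f 0 ℤ.+ z) (q^-·-< 1 (tail f) (s≤s z≤n))) (ℤ.+-identityʳ (f 0)))
    (suc n) → ≡.sym (≡.trans (ℤ.+-identityˡ _) (q^-·-+ 1 (tail f) n))

  ·-head+tail : ∀ {N} f g → f · g ≈[ N ] const (f 0) · g ⊕ q^ 1 · (tail f · g)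
  ·-head+tail f g = ≈-trans (·-congʳ (head+tail f))
    (solve 4 (λ c x f g → (c :+ x :* f) :* g := c :* g :+ x :* (f :* g)) ≈-refl (const (f 0)) (q^ 1) (tail f) g)
    where open Solver _

  ·-zero-coeff : ∀ f g → (f · g) 0 ≡ f 0 ℤ.* g 0
  ·-zero-coeff f g = refl

  tail-· : ∀ {N} f g → tail (f · g) ≈[ N ] const (f 0) · tail g ⊕ tail f · g
  tail-· f g = pointwise λ n → cong (ℤ._+ (tail f · g) n) (≡.sym (const-·ₙ (f 0) (tail g) n))

-- stretch k c f is q^c f(q^{k+1}).
stretch : ℕ → ℕ → PowerSeries → PowerSeries
stretch k zero    f zero    = f 0
stretch k zero    f (suc n) = stretch k k (tail f) n
stretch k (suc c) f zero    = 0ℤ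
stretch k (suc c) f (suc n) = stretch k c f n

stretch-cong : ∀ k c n {f g} → (∀ m → m ≤ n → f m ∼ g m) → stretch k c f n ∼ stretch k c g n
stretch-cong k zero    zero    p = p 0 z≤n
stretch-cong k zero    (suc n) p = stretch-cong k k n λ m m≤n → p (suc m) (s≤s m≤n)
stretch-cong k (suc c) zero    p = ∼-refl
stretch-cong k (suc c) (suc n) p = stretch-cong k c n λ m m≤n → p m (ℕ.m≤n⇒m≤1+n m≤n)

stretch-zero : ∀ k c n {f} → (∀ m → f m ≡ 0ℤ) → stretch k c f n ≡ 0ℤ
stretch-zero k zero    zero    p = p 0
stretch-zero k zero    (suc n) p = stretch-zero k k n (p ∘ suc)
stretch-zero k (suc c) zero    p = refl
stretch-zero k (suc c) (suc n) p = stretch-zero k c n p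

opaque
  unfolding _·_

  stretch-⊕ : ∀ k c n f g → stretch k c (f ⊕ g) n ≡ stretch k c f n ℤ.+ stretch k c g n
  stretch-⊕ k zero    zero    f g = refl
  stretch-⊕ k zero    (suc n) f g = stretch-⊕ k k n (tail f) (tail g)
  stretch-⊕ k (suc c) zero    f g = refl
  stretch-⊕ k (suc c) (suc n) f g = stretch-⊕ k c n f g

  stretch-scale : ∀ k c n a f → stretch k c (λ m → a ℤ.* f m) n ≡ a ℤ.* stretch k c f n
  stretch-scale k zero    zero    a f = refl
  stretch-scale k zero    (suc n) a f = stretch-scale k k n a (tail f)
  stretch-scale k (suc c) zero    a f = ≡.sym (ℤ.*-zeroʳ a)
  stretch-scale k (suc c) (suc n) a f = stretch-scale k c n a f

dilate : ℕ → PowerSeries → PowerSeries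
dilate k f = stretch k 0 f

dilate-cong : ∀ {N f g} k → f ≈[ N ] g → dilate k f ≈[ N ] dilate k g
dilate-cong k p = agree λ n n<N → stretch-cong k 0 n λ m m≤n → coeff p m (ℕ.≤-<-trans m≤n n<N)

dilate-⊕ : ∀ {N} k f g → dilate k (f ⊕ g) ≈[ N ] dilate k f ⊕ dilate k g
dilate-⊕ k f g = pointwise λ n → ≡.trans (stretch-⊕ k 0 n f g) (⊕ₙ n)
  where
  opaque
    unfolding _⊕_
    ⊕ₙ : ∀ n → stretch k 0 f n ℤ.+ stretch k 0 g n ≡ (dilate k f ⊕ dilate k g) n
    ⊕ₙ n = refl

opaque
  unfolding q^_

  stretch≈ : ∀ k c n f → stretch k c f n ≡ (q^ c · dilate k f) n
  stretch≈ k zero    n       f = ≡.sym (q^-·-+ 0 (dilate k f) n)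
  stretch≈ k (suc c) zero    f = refl
  stretch≈ k (suc c) (suc n) f = ≡.trans (stretch≈ k c n f) (≡.sym (shift-·ₙ (q^ c) (dilate k f) (suc n)))

  dilate-head+tail : ∀ {N} k f → dilate k f ≈[ N ] const (f 0) ⊕ q^ suc k · dilate k (tail f)
  dilate-head+tail k f = pointwise λ where
    zero    → ≡.sym (ℤ.+-identityʳ (f 0))
    (suc n) → ≡.trans (stretch≈ k k n (tail f))
                (≡.sym (≡.trans (ℤ.+-identityˡ _) (shift-·ₙ (q^ k) (dilate k (tail f)) (suc n))))

  dilate-const : ∀ {N} k c → dilate k (const c) ≈[ N ] const c
  dilate-const k c = pointwise λ where
    zero    → refl
    (suc n) → stretch-zero k k n λ _ → refl

  dilate-const-· : ∀ {N} k c f → dilate k (const c · f) ≈[ N ] const c · dilate k f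
  dilate-const-· k c f = ≈-trans (dilate-cong k (pointwise (const-·ₙ c f)))
    (pointwise λ n → ≡.trans (stretch-scale k 0 n c f) (≡.sym (const-·ₙ c (dilate k f) n)))

  dilate-q^ : ∀ {N} k n → dilate k (q^ n) ≈[ N ] q^ (n * suc k)
  dilate-q^ k zero    = dilate-const k 1ℤ
  dilate-q^ {N} k (suc n) = begin
    dilate k (q^ suc n)                          ≈⟨ dilate-head+tail k (q^ suc n) ⟩
    # 0 ⊕ q^ suc k · dilate k (q^ n)             ≈⟨ ⊕-identityˡ _ ⟩
    q^ suc k · dilate k (q^ n)                   ≈⟨ ·-congˡ (dilate-q^ k n) ⟩
    q^ suc k · q^ (n * suc k)                    ≈⟨ q^-+ (suc k) (n * suc k) ⟨
    q^ (suc n * suc k)                           ∎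
    where open ≈-Reasoning N

dilate-· : ∀ {N} k f g → dilate k (f · g) ≈[ N ] dilate k f · dilate k g
dilate-· {zero}  k f g = ≈-zero
dilate-· {suc N} k f g = begin
  dilate k (f · g)
    ≈⟨ dilate-head+tail k (f · g) ⟩
  const ((f · g) 0) ⊕ X · dilate k (tail (f · g))
    ≈⟨ ⊕-cong (≈-trans (const-cong (∼-reflexive (·-zero-coeff f g))) (const-· (f 0) (g 0)))
              (raise k (≈-trans (dilate-cong k (tail-· f g)) (≈-trans (dilate-⊕ k _ _)
                (⊕-cong (dilate-const-· k (f 0) (tail g)) (dilate-· k (tail f) g))))) ⟩
  const (f 0) · const (g 0) ⊕ X · (const (f 0) · dilate k (tail g) ⊕ dilate k (tail f) · dilate k g)
    ≈⟨ solve 6 (λ a b X f′ g′ g → a :* b :+ X :* (a :* g′ :+ f′ :* g) := a :* (b :+ X :* g′) :+ X :* f′ :* g)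
         ≈-refl (const (f 0)) (const (g 0)) X (dilate k (tail f)) (dilate k (tail g)) (dilate k g) ⟩
  const (f 0) · (const (g 0) ⊕ X · dilate k (tail g)) ⊕ X · dilate k (tail f) · dilate k g
    ≈⟨ ⊕-cong (·-congˡ (dilate-head+tail k g)) ≈-refl ⟨
  const (f 0) · dilate k g ⊕ X · dilate k (tail f) · dilate k g
    ≈⟨ solve 4 (λ a x g h → a :* h :+ x :* g :* h := (a :+ x :* g) :* h) ≈-refl (const (f 0)) X (dilate k (tail f)) (dilate k g) ⟩
  (const (f 0) ⊕ X · dilate k (tail f)) · dilate k g
    ≈⟨ ·-congʳ (dilate-head+tail k f) ⟨
  dilate k f · dilate k g ∎
  where
  X = q^ suc k
  open Solver (suc N)
  open ≈-Reasoning (suc N)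

-- Frobenius: f(q)^5 ≡ f(q^5)

infixr 8 _^⁵

_^⁵ : PowerSeries → PowerSeries
f ^⁵ = f · f · f · f · f

-- In (f(0) + q `tail f`)^5 the mixed binomial coefficients vanish, as the solver computes over 𝔽₅;
-- f(0)^5 ≡ f(0) by Fermat, and q^5 pays for the recursive call on the tail.
frobenius : ∀ {N} f → f ^⁵ ≈[ N ] dilate 4 f
frobenius {zero}  f = ≈-zero
frobenius {suc N} f = begin
  f ^⁵
    ≈⟨ ^⁵-cong (head+tail f) ⟩
  (const (f 0) ⊕ q^ 1 · tail f) ^⁵
    ≈⟨ solve 3 (λ c x f → (c :+ x :* f) :* (c :+ x :* f) :* (c :+ x :* f) :* (c :+ x :* f) :* (c :+ x :* f)
         := c :* c :* c :* c :* c :+ x :* x :* x :* x :* x :* (f :* f :* f :* f :* f)) ≈-refl (const (f 0)) (q^ 1) (tail f) ⟩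
  const (f 0) ^⁵ ⊕ (q^ 1) ^⁵ · tail f ^⁵
    ≈⟨ ⊕-cong (const⁵ (f 0)) (≈-trans (·-congʳ q⁵) (raise 4 (frobenius (tail f)))) ⟩
  const (f 0) ⊕ q^ 5 · dilate 4 (tail f)
    ≈⟨ dilate-head+tail 4 f ⟨
  dilate 4 f ∎
  where
  open Solver (suc N)
  open ≈-Reasoning (suc N)
  ^⁵-cong : ∀ {g h} → g ≈[ suc N ] h → g ^⁵ ≈[ suc N ] h ^⁵
  ^⁵-cong p = ·-cong (·-cong (·-cong (·-cong p p) p) p) p
  q⁵ : (q^ 1) ^⁵ ≈[ suc N ] q^ 5
  q⁵ = ≈-sym (≈-trans (q^-+ 4 1) (·-congʳ (≈-trans (q^-+ 3 1) (·-congʳ (≈-trans (q^-+ 2 1) (·-congʳ (q^-+ 1 1)))))))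
  const⁵ : ∀ x → const x ^⁵ ≈[ suc N ] const x
  const⁵ x = ≈-trans (≈-sym lem) (const-cong (∼-trans (∼-reflexive (powers x)) (fermat x)))
    where
    lem : const (x ℤ.* x ℤ.* x ℤ.* x ℤ.* x) ≈[ suc N ] const x ^⁵
    lem = ≈-trans (const-· _ x) (·-congʳ (≈-trans (const-· _ x) (·-congʳ (≈-trans (const-· _ x) (·-congʳ (const-· x x))))))
    powers : ∀ x → x ℤ.* x ℤ.* x ℤ.* x ℤ.* x ≡ x ℤ.* (x ℤ.* (x ℤ.* (x ℤ.* (x ℤ.* 1ℤ))))
    powers = solve-∀

-- The operators U_r

section : ℕ → PowerSeries → PowerSeries
section r f n = f (n * 5 + r)

section-cong : ∀ {N f g} r → f ≈[ N * 5 + suc r ] g → section r f ≈[ suc N ] section r g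
section-cong {N} r p = agree λ n n<N → coeff p (n * 5 + r)
  (subst (n * 5 + r <_) (≡.sym (ℕ.+-suc (N * 5) r)) (s≤s (ℕ.+-monoˡ-≤ r (ℕ.*-monoˡ-≤ 5 (s≤s⁻¹ n<N)))))

section-exact : ∀ {N f g} r → (∀ {M} → f ≈[ M ] g) → section r f ≈[ N ] section r g
section-exact {zero}  r p = ≈-zero
section-exact {suc N} r p = section-cong {N} r p

opaque
  unfolding q^_

  section-⊕ : ∀ {N} r f g → section r (f ⊕ g) ≈[ N ] section r f ⊕ section r g
  section-⊕ r f g = pointwise λ n → refl

  section-const-· : ∀ {N} r c f → section r (const c · f) ≈[ N ] const c · section r f
  section-const-· r c f = pointwise λ n → ≡.trans (const-·ₙ c f (n * 5 + r)) (≡.sym (const-·ₙ c (section r f) n))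

  section-q⁵· : ∀ {N} r → r < 5 → ∀ f → section r (q^ 5 · f) ≈[ N ] q^ 1 · section r f
  section-q⁵· r r<5 f = pointwise λ where
    zero    → ≡.trans (q^-·-< 5 f r<5) (≡.sym (q^-·-< 1 (section r f) (s≤s z≤n)))
    (suc n) → ≡.trans (q^-·-+ 5 f (n * 5 + r)) (≡.sym (q^-·-+ 1 (section r f) n))

-- U_r is linear over series in q^5. This is what lets the factor E(q^5) E(q^10) be pulled out of
-- U_2 and become E(q) E(q²).
section-dilate-· : ∀ {N} r → r < 5 → ∀ f g → section r (dilate 4 f · g) ≈[ N ] f · section r g
section-dilate-· {zero}  r r<5 f g = ≈-zero
section-dilate-· {suc N} r r<5 f g = begin
  section r (dilate 4 f · g)
    ≈⟨ section-exact r (λ {M} → ≈-trans (·-congʳ (dilate-head+tail 4 f))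
         (expand M (const (f 0)) (q^ 5) (dilate 4 (tail f)) g)) ⟩
  section r (const (f 0) · g ⊕ q^ 5 · (dilate 4 (tail f) · g))
    ≈⟨ section-⊕ r _ _ ⟩
  section r (const (f 0) · g) ⊕ section r (q^ 5 · (dilate 4 (tail f) · g))
    ≈⟨ ⊕-cong (section-const-· r (f 0) g)
              (≈-trans (section-q⁵· r r<5 (dilate 4 (tail f) · g)) (raise 0 (section-dilate-· r r<5 (tail f) g))) ⟩
  const (f 0) · section r g ⊕ q^ 1 · (tail f · section r g)
    ≈⟨ ·-head+tail f (section r g) ⟨
  f · section r g ∎
  where
  open ≈-Reasoning (suc N)
  expand : ∀ M c x f g → (c ⊕ x · f) · g ≈[ M ] c · g ⊕ x · (f · g)
  expand M = solve 4 (λ c x f g → (c :+ x :* f) :* g := c :* g :+ x :* (f :* g)) ≈-refl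
    where open Solver M

-- The derivation q d/dq

opaque
  unfolding q^_

  -- This is q d/dq. It turns "all exponents are ≡ c" into the equation ϑ f = c f, which `leibniz`
  -- propagates through products.
  ϑ : PowerSeries → PowerSeries
  ϑ f n = + n ℤ.* f n

  ϑ-cong : ∀ {N f g} → f ≈[ N ] g → ϑ f ≈[ N ] ϑ g
  ϑ-cong p = agree λ n n<N → ∼-* (∼-refl {+ n}) (coeff p n n<N)

  ϑ-⊕ : ∀ {N} f g → ϑ (f ⊕ g) ≈[ N ] ϑ f ⊕ ϑ g
  ϑ-⊕ f g = pointwise λ n → ℤ.*-distribˡ-+ (+ n) (f n) (g n)

  ϑ-const-· : ∀ {N} c f → ϑ (const c · f) ≈[ N ] const c · ϑ f
  ϑ-const-· c f = pointwise λ n → ≡.trans (cong (λ z → + n ℤ.* z) (const-·ₙ c f n))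
    (≡.trans (lem (+ n) c (f n)) (≡.sym (const-·ₙ c (ϑ f) n)))
    where
    lem : ∀ x y z → x ℤ.* (y ℤ.* z) ≡ y ℤ.* (x ℤ.* z)
    lem = solve-∀

  ϑ-q· : ∀ {N} f → ϑ (q^ 1 · f) ≈[ N ] q^ 1 · (f ⊕ ϑ f)
  ϑ-q· f = pointwise λ where
      zero    → refl
      (suc n) → ≡.trans (cong (λ z → + suc n ℤ.* z) (q^-·-+ 1 f n))
                  (≡.trans (lem (+ n) (f n)) (≡.sym (q^-·-+ 1 (f ⊕ ϑ f) n)))
    where
    lem : ∀ n x → (1ℤ ℤ.+ n) ℤ.* x ≡ x ℤ.+ n ℤ.* x
    lem = solve-∀

  ϑ-q^ : ∀ {N} k → ϑ (q^ k) ≈[ N ] const (+ k) · q^ k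
  ϑ-q^ k = pointwise λ n → ≡.trans (lem k n) (≡.sym (const-·ₙ (+ k) (q^ k) n))
    where
    lem : ∀ k n → + n ℤ.* (q^ k) n ≡ + k ℤ.* (q^ k) n
    lem zero    zero    = refl
    lem zero    (suc n) = ℤ.*-zeroʳ (+ suc n)
    lem (suc k) zero    = ≡.sym (ℤ.*-zeroʳ (+ suc k))
    lem (suc k) (suc n) = ≡.trans (ℤ.suc-* (+ n) ((q^ k) n))
      (≡.trans (cong (λ z → (q^ k) n ℤ.+ z) (lem k n)) (≡.sym (ℤ.suc-* (+ k) ((q^ k) n))))

  -- ϑ f = c f forces the exponents of f to be ≡ c.
  section-eigen : ∀ {M N f} r c e → e ℤ.* (+ r ℤ.- c) ∼ 1ℤ → ϑ f ≈[ M ] const c · f →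
                  (∀ n → n < N → n * 5 + r < M) → section r f ≈[ N ] # 0
  section-eigen {f = f} r c e e-inv p bound = agree λ n n<N →
    ∼-trans (vanish (n * 5 + r) (residue n) (∼-trans (coeff p _ (bound n n<N)) (∼-reflexive (const-·ₙ c f _)))) (∼-reflexive (const0 n))
    where
    const0 : ∀ n → 0ℤ ≡ const 0ℤ n
    const0 zero    = refl
    const0 (suc _) = refl
    residue : ∀ n → + (n * 5 + r) ∼ + r
    residue n = by-quotient (+ n) (≡.trans (ℤ.pos-+ (n * 5) r) (≡.trans (ℤ.+-comm (+ (n * 5)) (+ r)) (cong (λ z → + r ℤ.+ z) (ℤ.pos-* n 5))))
    vanish : ∀ m → + m ∼ + r → + m ℤ.* f m ∼ c ℤ.* f m → f m ∼ 0ℤ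
    -- With e the inverse of r - c: f m ≡ e (r - c) f m ≡ e (m f m - c f m) ≡ 0.
    vanish m m∼r m∼c = ∼-trans (∼-reflexive (≡.sym (ℤ.*-identityˡ (f m)))) (∼-trans (∼-* (∼-sym e-inv) (∼-refl {f m}))
      (∼-trans (∼-reflexive (lem₁ e (+ r) c (f m))) (∼-trans (∼-* (∼-refl {e}) (∼-+ (∼-trans (∼-* (∼-sym m∼r) (∼-refl {f m})) m∼c) (∼-refl {ℤ.- (c ℤ.* f m)})))
        (∼-reflexive (lem₂ e (c ℤ.* f m))))))
      where
      lem₁ : ∀ e r c x → e ℤ.* (r ℤ.- c) ℤ.* x ≡ e ℤ.* (r ℤ.* x ℤ.+ ℤ.- (c ℤ.* x))
      lem₁ = solve-∀
      lem₂ : ∀ e x → e ℤ.* (x ℤ.+ ℤ.- x) ≡ 0ℤ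
      lem₂ = solve-∀

ϑ-const : ∀ {N} c → ϑ (const c) ≈[ N ] # 0
ϑ-const {N} c = ≈-trans (ϑ-cong (solve 1 (λ c → c := c :* con 1) ≈-refl (const c))) (≈-trans (ϑ-const-· c (# 1))
  (≈-trans (·-congˡ (≈-trans (ϑ-cong (SeriesEq.reflexive (≡.sym q^0))) (≈-trans (ϑ-q^ 0) (·-zeroˡ _)))) (·-zeroʳ _)))
  where open Solver N

ϑ-tail : ∀ {N} f → ϑ f ≈[ N ] q^ 1 · (tail f ⊕ ϑ (tail f))
ϑ-tail f = ≈-trans (ϑ-cong (head+tail f)) (≈-trans (ϑ-⊕ (const (f 0)) _) (≈-trans (⊕-cong (ϑ-const (f 0)) (ϑ-q· (tail f))) (⊕-identityˡ _)))

leibniz : ∀ {N} f g → ϑ (f · g) ≈[ N ] ϑ f · g ⊕ f · ϑ g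
leibniz {zero}  f g = ≈-zero
leibniz {suc N} f g = begin
  ϑ (f · g)
    ≈⟨ ϑ-cong (·-head+tail f g) ⟩
  ϑ (c · g ⊕ X · (f′ · g))
    ≈⟨ ≈-trans (ϑ-⊕ _ _) (⊕-cong (ϑ-const-· (f 0) g) (ϑ-q· _)) ⟩
  c · ϑ g ⊕ X · (f′ · g ⊕ ϑ (f′ · g))
    ≈⟨ ⊕-cong ≈-refl (raise 0 (⊕-cong ≈-refl (leibniz f′ g))) ⟩
  c · ϑ g ⊕ X · (f′ · g ⊕ (ϑ f′ · g ⊕ f′ · ϑ g))
    ≈⟨ solve 6 (λ c X f′ f″ g g′ → c :* g′ :+ X :* (f′ :* g :+ (f″ :* g :+ f′ :* g′))
         := X :* (f′ :+ f″) :* g :+ (c :+ X :* f′) :* g′) ≈-refl c X f′ (ϑ f′) g (ϑ g) ⟩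
  X · (f′ ⊕ ϑ f′) · g ⊕ (c ⊕ X · f′) · ϑ g
    ≈⟨ ⊕-cong (·-congʳ (ϑ-tail f)) (·-congʳ (head+tail f)) ⟨
  ϑ f · g ⊕ f · ϑ g ∎
  where
  c = const (f 0)
  X = q^ 1
  f′ = tail f
  open Solver (suc N)
  open ≈-Reasoning (suc N)

-- The coefficients a(n)

-- The local functions of divGeom and cubicSeries cannot be named from here. Unification finds them: once
-- their arguments have been abstracted to distinct variables, matching a goal determines the underscore.
mutual
  divGeomGo : ℕ → Series → ℕ → ℕ → ℕ → ℕ
  divGeomGo = _

  divGeom-unfold : ∀ k f n → divGeom k f (suc n) ≡ f (suc n) + (if n <ᵇ k then 0 else divGeomGo k f (suc n) n (n ∸ k))
  divGeom-unfold k f n with n | suc n | n ∸ k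
  ... | _ | _ | _ = refl

mutual
  cubicGo : ℕ → Series → ℕ → Series
  cubicGo = _

  cubicSeries-unfold : ∀ n → cubicSeries (suc n) ≡ divGeom (2 * suc n ∸ 1) (cubicGo (suc n) (invProd 0 (suc n)) n)
  cubicSeries-unfold n with n | suc n | invProd 0 (suc n)
  ... | _ | _ | _ = refl

-- Each step lowers `r` by at least one, so fuel `r` is enough. The recursive call inside
-- `divGeom k f (suc k + n)` carries another fuel and another outer index than `divGeom k f n`,
-- hence both vary.
divGeomGo-fuel : ∀ k f n n′ t t′ r → r ≤ t → r ≤ t′ → divGeomGo k f n t r ≡ divGeomGo k f n′ t′ r
divGeomGo-fuel k f n n′ zero    zero     zero r≤t r≤t′ = refl
divGeomGo-fuel k f n n′ zero    (suc t′) zero r≤t r≤t′ = ≡.sym (ℕ.+-identityʳ (f 0))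
divGeomGo-fuel k f n n′ (suc t) zero     zero r≤t r≤t′ = ℕ.+-identityʳ (f 0)
divGeomGo-fuel k f n n′ (suc t) (suc t′) r r≤t r≤t′ with r <ᵇ suc k
... | true  = refl
... | false = cong (λ z → f r + z) (divGeomGo-fuel k f n n′ t t′ (r ∸ suc k) (bound r≤t) (bound r≤t′))
  where
  bound : ∀ {t} → r ≤ suc t → r ∸ suc k ≤ t
  bound r≤1+t = ℕ.≤-trans (ℕ.∸-monoˡ-≤ (suc k) r≤1+t) (ℕ.m∸n≤m _ k)

<⇒<ᵇ≡true : ∀ {m n} → m < n → (m <ᵇ n) ≡ true
<⇒<ᵇ≡true {zero}  {suc n} _   = refl
<⇒<ᵇ≡true {suc m} {suc n} m<n = <⇒<ᵇ≡true (s≤s⁻¹ m<n)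

m+n<ᵇm≡false : ∀ m n → (m + n <ᵇ m) ≡ false
m+n<ᵇm≡false zero    n = refl
m+n<ᵇm≡false (suc m) n = m+n<ᵇm≡false m n

divGeom-< : ∀ k f {n} → n < suc k → divGeom k f n ≡ f n
divGeom-< k f {zero}  _ = refl
divGeom-< k f {suc n} n<k rewrite <⇒<ᵇ≡true n<k = ℕ.+-identityʳ (f (suc n))

divGeom-+ : ∀ k f n → divGeom k f (suc k + n) ≡ f (suc k + n) + divGeom k f n
divGeom-+ k f n rewrite m+n<ᵇm≡false k n = cong (λ z → f (suc k + n) + z)
  (≡.trans (cong (divGeomGo k f (suc k + n) (k + n)) (ℕ.m+n∸m≡n k n))
    (divGeomGo-fuel k f (suc k + n) n (k + n) n n (ℕ.m≤n+m n k) ℕ.≤-refl))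

fromℕ : Series → PowerSeries
fromℕ f n = + f n

divGeom-inverse : ∀ {N} k f → (# 1 ⊖ q^ suc k) · fromℕ (divGeom k f) ≈[ N ] fromℕ f
divGeom-inverse {N} k f = begin
  (# 1 ⊖ X) · fromℕ g           ≈⟨ solve 2 (λ X g → (con 1 :- X) :* g := g :- X :* g) ≈-refl X (fromℕ g) ⟩
  fromℕ g ⊖ X · fromℕ g         ≈⟨ ⊕-cong expand ≈-refl ⟩
  (fromℕ f ⊕ X · fromℕ g) ⊖ X · fromℕ g
    ≈⟨ solve 3 (λ X f g → (f :+ X :* g) :- X :* g := f) ≈-refl X (fromℕ f) (fromℕ g) ⟩
  fromℕ f                       ∎
  where
  g = divGeom k f
  X = q^ suc k
  open Solver N
  open ≈-Reasoning N
  opaque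
    unfolding q^_
    expand : fromℕ g ≈[ N ] fromℕ f ⊕ X · fromℕ g
    expand = pointwise λ n → split n (n <? suc k)
      where
      split : ∀ n → Dec (n < suc k) → fromℕ g n ≡ (fromℕ f ⊕ X · fromℕ g) n
      split n (yes n<k) = ≡.trans (cong +_ (divGeom-< k f n<k))
        (≡.sym (≡.trans (cong (λ z → + f n ℤ.+ z) (q^-·-< (suc k) (fromℕ g) n<k)) (ℤ.+-identityʳ _)))
      split n (no n≮k) = subst (λ n → fromℕ g n ≡ (fromℕ f ⊕ X · fromℕ g) n) (ℕ.m+[n∸m]≡n (ℕ.≮⇒≥ n≮k))
        (≡.trans (cong +_ (divGeom-+ k f m)) (cong (λ z → + f (suc k + m) ℤ.+ z) (≡.sym (q^-·-+ (suc k) (fromℕ g) m))))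
        where
        m : ℕ
        m = n ∸ suc k

-- Finite Euler products and the inverse of the generating function

euler : ℕ → PowerSeries
euler zero    = # 1
euler (suc n) = euler n · (# 1 ⊖ q^ suc n)

opaque
  unfolding q^_

  euler⁻¹ : ℕ → PowerSeries
  euler⁻¹ n = fromℕ (invProd 0 n)

  euler⁻¹-zero : ∀ {N} → euler⁻¹ 0 ≈[ N ] # 1
  euler⁻¹-zero = pointwise λ where
    zero    → refl
    (suc _) → refl

  euler⁻¹-suc : ∀ {N} n → (# 1 ⊖ q^ suc n) · euler⁻¹ (suc n) ≈[ N ] euler⁻¹ n
  -- The index `1 * suc n ∸ 1` in `invProd` computes to `n + 0`.
  euler⁻¹-suc {N} n = subst (λ k → (# 1 ⊖ q^ suc k) · euler⁻¹ (suc n) ≈[ N ] euler⁻¹ n) (ℕ.+-identityʳ n)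
    (divGeom-inverse (n + 0) (invProd 0 n))

euler-inverse : ∀ {N} n → euler n · euler⁻¹ n ≈[ N ] # 1
euler-inverse zero        = ≈-trans (·-identityˡ _) euler⁻¹-zero
euler-inverse {N} (suc n) = ≈-trans (·-assoc _ _ _) (≈-trans (·-congˡ (euler⁻¹-suc n)) (euler-inverse n))

dilate-1⊖ : ∀ {N} k f → dilate k (# 1 ⊖ f) ≈[ N ] # 1 ⊖ dilate k f
dilate-1⊖ {N} k f = begin
  -- Negation is multiplication by 4 modulo 5, which reduces the claim to linearity.
  dilate k (# 1 ⊖ f)         ≈⟨ dilate-cong k (solve 1 (λ f → con 1 :- f := con 1 :+ con 4 :* f) ≈-refl f) ⟩
  dilate k (# 1 ⊕ # 4 · f)   ≈⟨ ≈-trans (dilate-⊕ k _ _) (⊕-cong (dilate-const k (+ 1)) (dilate-const-· k (+ 4) f)) ⟩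
  # 1 ⊕ # 4 · dilate k f     ≈⟨ solve 1 (λ f → con 1 :+ con 4 :* f := con 1 :- f) ≈-refl (dilate k f) ⟩
  # 1 ⊖ dilate k f           ∎
  where
  open Solver N
  open ≈-Reasoning N

dilate-euler-suc : ∀ {N} n → dilate 1 (euler (suc n)) ≈[ N ] dilate 1 (euler n) · (# 1 ⊖ q^ (suc n * 2))
dilate-euler-suc n = ≈-trans (dilate-· 1 (euler n) _)
  (·-congˡ (≈-trans (dilate-1⊖ 1 (q^ suc n)) (⊕-cong ≈-refl (neg-cong (dilate-q^ 1 (suc n))))))

cubicGo-inverse : ∀ {N} m f n → dilate 1 (euler n) · fromℕ (cubicGo m f n) ≈[ N ] fromℕ f
cubicGo-inverse m f zero = ≈-trans (·-congʳ (dilate-const 1 (+ 1))) (·-identityˡ _)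
cubicGo-inverse {N} m f (suc n) =
  ≈-trans (·-congʳ (dilate-euler-suc n)) (≈-trans (·-assoc _ _ _) (≈-trans (·-congˡ step) (cubicGo-inverse m f n)))
  where
  step : (# 1 ⊖ q^ (suc n * 2)) · fromℕ (cubicGo m f (suc n)) ≈[ N ] fromℕ (cubicGo m f n)
  step = subst (λ k → (# 1 ⊖ q^ k) · fromℕ (cubicGo m f (suc n)) ≈[ N ] fromℕ (cubicGo m f n)) (ℕ.*-comm 2 (suc n))
    (divGeom-inverse (2 * suc n ∸ 1) (cubicGo m f n))

opaque
  unfolding euler⁻¹

  -- True to every precision, because the same finite products stand on both sides of the
  -- cancellation.
  cubic-inverse : ∀ {N} n → euler n · dilate 1 (euler n) · fromℕ (cubicSeries n) ≈[ N ] # 1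
  cubic-inverse n = ≈-trans (·-assoc _ _ _) (≈-trans (·-congˡ (cubicGo-inverse n (invProd 0 n) n)) (euler-inverse n))

-- Finite sums

∑ : ℕ → (ℕ → PowerSeries) → PowerSeries
∑ zero    f = # 0
∑ (suc n) f = ∑ n f ⊕ f n

syntax ∑ n (λ k → f) = ∑[ k < n ] f

∑-cong : ∀ {N f g} n → (∀ k → k < n → f k ≈[ N ] g k) → ∑ n f ≈[ N ] ∑ n g
∑-cong zero    p = ≈-refl
∑-cong (suc n) p = ⊕-cong (∑-cong n λ k k<n → p k (ℕ.m≤n⇒m≤1+n k<n)) (p n ℕ.≤-refl)

∑-⊕ : ∀ {N} n f g → ∑ n (λ k → f k ⊕ g k) ≈[ N ] ∑ n f ⊕ ∑ n g
∑-⊕ zero    f g = ≈-sym (⊕-identityˡ _)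
∑-⊕ {N} (suc n) f g = ≈-trans (⊕-cong (∑-⊕ n f g) ≈-refl)
  (solve 4 (λ a b c d → (a :+ b) :+ (c :+ d) := (a :+ c) :+ (b :+ d)) ≈-refl (∑ n f) (∑ n g) (f n) (g n))
  where open Solver N

∑-·ˡ : ∀ {N} n c f → c · ∑ n f ≈[ N ] ∑[ k < n ] (c · f k)
∑-·ˡ zero    c f = ·-zeroʳ c
∑-·ˡ (suc n) c f = ≈-trans (SeriesEq.distribˡ c _ _) (⊕-cong (∑-·ˡ n c f) ≈-refl)

∑-·ʳ : ∀ {N} n c f → ∑ n f · c ≈[ N ] ∑[ k < n ] (f k · c)
∑-·ʳ n c f = ≈-trans (·-comm _ c) (≈-trans (∑-·ˡ n c f) (∑-cong n λ k _ → ·-comm c (f k)))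

∑-zero : ∀ {N f} n → (∀ k → k < n → f k ≈[ N ] # 0) → ∑ n f ≈[ N ] # 0
∑-zero zero    p = ≈-refl
∑-zero (suc n) p = ≈-trans (⊕-cong (∑-zero n λ k k<n → p k (ℕ.m≤n⇒m≤1+n k<n)) (p n ℕ.≤-refl)) (⊕-identityˡ _)

∑-head : ∀ {N} n f → ∑ (suc n) f ≈[ N ] f 0 ⊕ ∑ n (f ∘ suc)
∑-head zero    f = SeriesEq.+-comm _ _
∑-head (suc n) f = ≈-trans (⊕-cong (∑-head n f) ≈-refl) (SeriesEq.+-assoc _ _ _)

∑-swap : ∀ {N} m n (f : ℕ → ℕ → PowerSeries) → ∑[ i < m ] ∑[ j < n ] f i j ≈[ N ] ∑[ j < n ] ∑[ i < m ] f i j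
∑-swap zero    n f = ≈-sym (∑-zero n λ _ _ → ≈-refl)
∑-swap (suc m) n f = ≈-trans (⊕-cong (∑-swap m n f) ≈-refl) (≈-sym (∑-⊕ n _ _))

-- A finite form of the Jacobi triple product

-- The value at m - 1, where index -1 is read as 0: the weights and the `gauss` coefficients are
-- symmetric under m ↦ -1 - m, and only half of each sequence is kept.
prev : {A : Set} → (ℕ → A) → ℕ → A
prev c zero    = c 0
prev c (suc m) = c m

-- △ m = m(m-1)/2; the exponents of the theta series are △ (1+m).
△ : ℕ → ℕ
△ zero    = 0
△ (suc m) = △ m + m

m≤△[1+m] : ∀ m → m ≤ △ (suc m)
m≤△[1+m] m = ℕ.m≤n+m m (△ m)

-- 1/(q;q)_{j-1}, with 1/(q;q)_{-1} = 0.
euler⁻¹-pred : ℕ → PowerSeries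
euler⁻¹-pred zero    = # 0
euler⁻¹-pred (suc j) = euler⁻¹ j

euler⁻¹-pred-suc : ∀ {N} j → euler⁻¹-pred j ≈[ N ] (# 1 ⊖ q^ j) · euler⁻¹ j
euler⁻¹-pred-suc {N} zero = begin
  # 0                           ≈⟨ solve 1 (λ e → con 0 := (con 1 :- con 1) :* e) ≈-refl (euler⁻¹ 0) ⟩
  (# 1 ⊖ # 1) · euler⁻¹ 0       ≡⟨ cong (λ z → (# 1 ⊖ z) · euler⁻¹ 0) q^0 ⟨
  (# 1 ⊖ q^ 0) · euler⁻¹ 0      ∎
  where
  open Solver N
  open ≈-Reasoning N
euler⁻¹-pred-suc (suc j) = ≈-sym (euler⁻¹-suc j)

-- This is 1/(q;q)_{d-2} = (1 - q^{d-1})(1 - q^d)/(q;q)_d, multiplied by q so that the exponent d -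
-- 1 disappears and d = 0, where `∸` truncates, is covered too.
q·euler⁻¹-pred : ∀ {N} d → q^ 1 · euler⁻¹-pred (d ∸ 1) ≈[ N ] (q^ 1 ⊖ q^ d) · (# 1 ⊖ q^ d) · euler⁻¹ d
q·euler⁻¹-pred {N} zero = begin
  q^ 1 · # 0                                     ≈⟨ solve 2 (λ q e → q :* con 0 := (q :- con 1) :* (con 1 :- con 1) :* e) ≈-refl (q^ 1) (euler⁻¹ 0) ⟩
  (q^ 1 ⊖ # 1) · (# 1 ⊖ # 1) · euler⁻¹ 0         ≡⟨ cong (λ z → (q^ 1 ⊖ z) · (# 1 ⊖ z) · euler⁻¹ 0) q^0 ⟨
  (q^ 1 ⊖ q^ 0) · (# 1 ⊖ q^ 0) · euler⁻¹ 0       ∎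
  where
  open Solver N
  open ≈-Reasoning N
q·euler⁻¹-pred {N} (suc d) = begin
  q^ 1 · euler⁻¹-pred d
    ≈⟨ ·-congˡ (≈-trans (euler⁻¹-pred-suc d) (·-congˡ (≈-sym (euler⁻¹-suc d)))) ⟩
  q^ 1 · ((# 1 ⊖ q^ d) · ((# 1 ⊖ q^ suc d) · euler⁻¹ (suc d)))
    ≈⟨ solve 4 (λ q z w e → q :* ((con 1 :- z) :* ((con 1 :- w) :* e)) := (q :- q :* z) :* (con 1 :- w) :* e) ≈-refl (q^ 1) (q^ d) (q^ suc d) (euler⁻¹ (suc d)) ⟩
  (q^ 1 ⊖ q^ 1 · q^ d) · (# 1 ⊖ q^ suc d) · euler⁻¹ (suc d)
    ≈⟨ ·-congʳ (·-congʳ (⊕-cong ≈-refl (neg-cong (q^-+ 1 d)))) ⟨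
  (q^ 1 ⊖ q^ suc d) · (# 1 ⊖ q^ suc d) · euler⁻¹ (suc d) ∎
  where
  open Solver N
  open ≈-Reasoning N

-- q^{m(m+1)/2} times the Gaussian binomial coefficient [2n+1 choose n-m].
gauss : ℕ → ℕ → PowerSeries
gauss n m = q^ △ (suc m) · euler (suc (n + n)) · euler⁻¹-pred (suc n ∸ m) · euler⁻¹ (suc (n + m))

-- At m = 0 the two denominators trade places: this is the symmetry of the Gaussian binomial
-- coefficient on which the convention for `prev` rests.
gauss-prev : ∀ {N} n m → prev (gauss n) m ≈[ N ] q^ △ m · euler (suc (n + n)) · euler⁻¹-pred (suc (suc n) ∸ m) · euler⁻¹ (n + m)
gauss-prev {N} n zero rewrite ℕ.+-identityʳ n =
  solve 4 (λ q p e f → q :* p :* e :* f := q :* p :* f :* e) ≈-refl (q^ 0) (euler (suc (n + n))) (euler⁻¹ n) (euler⁻¹ (suc n))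
  where open Solver N
gauss-prev n (suc m) rewrite ℕ.+-suc n m = ≈-refl

euler-double-suc : ∀ {N} n → euler (suc (suc n + suc n)) ≈[ N ]
  euler (suc (n + n)) · (# 1 ⊖ q^ suc n · q^ suc n) · (# 1 ⊖ q^ 1 · (q^ suc n · q^ suc n))
euler-double-suc {N} n = ≈-trans (SeriesEq.reflexive (cong (λ z → euler (suc (suc z))) (ℕ.+-suc n n)))
  (·-cong (·-congˡ (⊕-cong ≈-refl (neg-cong even))) (⊕-cong ≈-refl (neg-cong (≈-trans (q^-+ 1 (suc (suc (n + n)))) (·-congˡ even)))))
  where
  even : q^ suc (suc (n + n)) ≈[ N ] q^ suc n · q^ suc n
  even = ≈-trans (SeriesEq.reflexive (cong (λ z → q^ suc z) (≡.sym (ℕ.+-suc n n)))) (q^-+ (suc n) (suc n))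

-- The effect on coefficients of the new factor (1 + z X)(1 + X/z) with X = q^{n+1}. For m ≤ n + 1
-- all terms are put over (q;q)_{n+1-m} and (q;q)_{n+m+2}; with Y = q^m, Z = q^{n+1-m} and X = Y Z,
-- a polynomial identity remains. For larger m every term is 0.
gauss-suc : ∀ {N} n m → gauss (suc n) m ≈[ N ]
  (# 1 ⊕ q^ suc n · q^ suc n) · gauss n m ⊕ q^ suc n · (gauss n (suc m) ⊕ prev (gauss n) m)
gauss-suc {N} n m with m ≤? suc n
... | no m≰1+n = begin
  gauss (suc n) m
    ≈⟨ vanish _ _ 2+n∸m≡0 ⟩
  # 0
    ≈⟨ solve 1 (λ X → con 0 := (con 1 :+ X :* X) :* con 0 :+ X :* (con 0 :+ con 0)) ≈-refl X ⟩
  (# 1 ⊕ X · X) · # 0 ⊕ X · (# 0 ⊕ # 0)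
    ≈⟨ ⊕-cong (·-congˡ (vanish _ _ (ℕ.m≤n⇒m∸n≡0 (ℕ.<⇒≤ 2+n≤m))))
         (·-congˡ (⊕-cong (vanish _ _ (ℕ.m≤n⇒m∸n≡0 (ℕ.<⇒≤ (ℕ.<⇒≤ 2+n≤m))))
           (≈-trans (gauss-prev n m) (vanish _ _ 2+n∸m≡0)))) ⟨
  (# 1 ⊕ X · X) · gauss n m ⊕ X · (gauss n (suc m) ⊕ prev (gauss n) m) ∎
  where
  X = q^ suc n
  open Solver N
  open ≈-Reasoning N
  2+n≤m : suc (suc n) ≤ m
  2+n≤m = ℕ.≰⇒> m≰1+n
  2+n∸m≡0 : suc (suc n) ∸ m ≡ 0
  2+n∸m≡0 = ℕ.m≤n⇒m∸n≡0 2+n≤m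
  vanish : ∀ {i} A B → i ≡ 0 → A · euler⁻¹-pred i · B ≈[ N ] # 0
  vanish A B refl = ≈-trans (·-congʳ (·-zeroʳ A)) (·-zeroˡ B)
... | yes m≤1+n = begin
  gauss (suc n) m
    ≈⟨ ·-congʳ (·-cong (·-cong P₁ (euler-double-suc n)) (SeriesEq.reflexive (cong euler⁻¹-pred 2+n∸m))) ⟩
  P · Y · (E · (# 1 ⊖ X · X) · (# 1 ⊖ q · (X · X))) · G · H
    ≈⟨ ·-congʳ (·-congʳ (·-congˡ (·-cong (·-congˡ (⊕-cong ≈-refl (neg-cong (·-cong X≈ X≈)))) (⊕-cong ≈-refl (neg-cong (·-congˡ (·-cong X≈ X≈))))))) ⟩
  P · Y · (E · (# 1 ⊖ Y · Z · (Y · Z)) · (# 1 ⊖ q · (Y · Z · (Y · Z)))) · G · H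
    ≈⟨ solve 7 (λ P Y Z q E G H →
         P :* Y :* (E :* (con 1 :- Y :* Z :* (Y :* Z)) :* (con 1 :- q :* (Y :* Z :* (Y :* Z)))) :* G :* H
         := (con 1 :+ Y :* Z :* (Y :* Z)) :* (P :* Y :* E :* ((con 1 :- Z) :* G) :* ((con 1 :- q :* (Y :* Z :* Y)) :* H))
            :+ Y :* Z :* (P :* Y :* Y :* E :* ((q :- Z) :* (con 1 :- Z) :* G) :* H
                         :+ P :* E :* G :* ((con 1 :- Y :* Z :* Y) :* ((con 1 :- q :* (Y :* Z :* Y)) :* H))))
         ≈-refl P Y Z q E G H ⟩
  (# 1 ⊕ Y · Z · (Y · Z)) · (P · Y · E · ((# 1 ⊖ Z) · G) · ((# 1 ⊖ q · (Y · Z · Y)) · H))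
    ⊕ Y · Z · (P · Y · Y · E · ((q ⊖ Z) · (# 1 ⊖ Z) · G) · H
              ⊕ P · E · G · ((# 1 ⊖ Y · Z · Y) · ((# 1 ⊖ q · (Y · Z · Y)) · H)))
    ≈⟨ ⊕-cong (·-cong (⊕-cong ≈-refl (·-cong X≈ X≈)) (·-cong (·-cong (·-congʳ P₁) (euler⁻¹-pred-suc d)) H₁))
         (·-cong X≈ (⊕-cong middle (≈-trans (gauss-prev n m) (·-cong (·-congˡ (SeriesEq.reflexive (cong euler⁻¹-pred 2+n∸m))) H₂)))) ⟨
  (# 1 ⊕ X · X) · gauss n m ⊕ X · (gauss n (suc m) ⊕ prev (gauss n) m) ∎
  where
  d = suc n ∸ m
  q = q^ 1
  X = q^ suc n
  P = q^ △ m
  Y = q^ m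
  Z = q^ d
  E = euler (suc (n + n))
  G = euler⁻¹ d
  H = euler⁻¹ (suc (suc (n + m)))
  open Solver N
  open ≈-Reasoning N
  2+n∸m : suc (suc n) ∸ m ≡ suc d
  2+n∸m = ℕ.+-∸-assoc 1 m≤1+n
  n∸m : n ∸ m ≡ d ∸ 1
  n∸m = ≡.sym (≡.trans (ℕ.∸-+-assoc (suc n) m 1) (cong (suc n ∸_) (ℕ.+-comm m 1)))
  X≈ : X ≈[ N ] Y · Z
  X≈ = ≈-trans (SeriesEq.reflexive (cong q^_ (≡.sym (ℕ.m+[n∸m]≡n m≤1+n)))) (q^-+ m d)
  P₁ : q^ △ (suc m) ≈[ N ] P · Y
  P₁ = q^-+ (△ m) m
  XY : q^ (suc n + m) ≈[ N ] Y · Z · Y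
  XY = ≈-trans (q^-+ (suc n) m) (·-congʳ X≈)
  H₁ : euler⁻¹ (suc (n + m)) ≈[ N ] (# 1 ⊖ q · (Y · Z · Y)) · H
  H₁ = ≈-trans (≈-sym (euler⁻¹-suc _)) (·-congʳ (⊕-cong ≈-refl (neg-cong (≈-trans (q^-+ 1 (suc n + m)) (·-congˡ XY)))))
  H₂ : euler⁻¹ (n + m) ≈[ N ] (# 1 ⊖ Y · Z · Y) · ((# 1 ⊖ q · (Y · Z · Y)) · H)
  H₂ = ≈-trans (≈-sym (euler⁻¹-suc _)) (·-cong (⊕-cong ≈-refl (neg-cong XY)) H₁)
  middle : gauss n (suc m) ≈[ N ] P · Y · Y · E · ((q ⊖ Z) · (# 1 ⊖ Z) · G) · H
  middle = begin
    gauss n (suc m)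
      ≈⟨ ·-cong (·-cong (·-congʳ (≈-trans (q^-+ (△ (suc m)) (suc m)) (·-cong P₁ (q^-+ 1 m))))
           (SeriesEq.reflexive (cong euler⁻¹-pred n∸m))) (SeriesEq.reflexive (cong (λ z → euler⁻¹ (suc z)) (ℕ.+-suc n m))) ⟩
    P · Y · (q · Y) · E · euler⁻¹-pred (d ∸ 1) · H
      ≈⟨ solve 6 (λ P Y q E G H → P :* Y :* (q :* Y) :* E :* G :* H := P :* Y :* Y :* E :* (q :* G) :* H) ≈-refl P Y q E (euler⁻¹-pred (d ∸ 1)) H ⟩
    P · Y · Y · E · (q · euler⁻¹-pred (d ∸ 1)) · H
      ≈⟨ ·-congʳ (·-congˡ (q·euler⁻¹-pred d)) ⟩
    P · Y · Y · E · ((q ⊖ Z) · (# 1 ⊖ Z) · G) · H ∎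

-- The operator c ↦ (m ↦ c (m + 1) + `prev` c m) is symmetric up to a boundary term, and `u` is an
-- eigenvector with eigenvalue `t`. At the lower end the reflection in `prev` leaves no boundary
-- term.
∑-by-parts : ∀ {N} t u c → (∀ m → t ℤ.* u m ≡ u (suc m) ℤ.+ prev u m) → ∀ M →
  ∑[ m < M ] (const (u m) · (c (suc m) ⊕ prev c m)) ≈[ N ]
  const t · ∑[ m < M ] (const (u m) · c m) ⊕ (const (prev u M) · c M ⊖ const (u M) · prev c M)
∑-by-parts {N} t u c rec zero =
  solve 3 (λ t u c → con 0 := t :* con 0 :+ (u :* c :- u :* c)) ≈-refl (const t) (const (u 0)) (c 0)
  where open Solver N
∑-by-parts {N} t u c rec (suc M) = begin
  ∑[ m < M ] (const (u m) · (c (suc m) ⊕ prev c m)) ⊕ U · (C₊ ⊕ C₋)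
    ≈⟨ ⊕-cong (∑-by-parts t u c rec M) ≈-refl ⟩
  T · S ⊕ (U₋ · C ⊖ U · C₋) ⊕ U · (C₊ ⊕ C₋)
    ≈⟨ solve 8 (λ T S U₋ U U₊ C₋ C C₊ → T :* S :+ (U₋ :* C :- U :* C₋) :+ U :* (C₊ :+ C₋)
         := T :* S :+ (U₊ :+ U₋) :* C :+ (U :* C₊ :- U₊ :* C)) ≈-refl T S U₋ U U₊ C₋ C C₊ ⟩
  T · S ⊕ (U₊ ⊕ U₋) · C ⊕ (U · C₊ ⊖ U₊ · C)
    ≈⟨ ⊕-cong (⊕-cong ≈-refl (·-congʳ TU)) ≈-refl ⟨
  T · S ⊕ T · U · C ⊕ (U · C₊ ⊖ U₊ · C)
    ≈⟨ solve 5 (λ T S U C r → T :* S :+ T :* U :* C :+ r := T :* (S :+ U :* C) :+ r) ≈-refl T S U C (U · C₊ ⊖ U₊ · C) ⟩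
  T · (S ⊕ U · C) ⊕ (U · C₊ ⊖ U₊ · C) ∎
  where
  T = const t
  S = ∑[ m < M ] (const (u m) · c m)
  U₋ = const (prev u M)
  U = const (u M)
  U₊ = const (u (suc M))
  C₋ = prev c M
  C = c M
  C₊ = c (suc M)
  open Solver N
  open ≈-Reasoning N
  TU : T · U ≈[ N ] U₊ ⊕ U₋
  TU = ≈-trans (≈-sym (const-· t (u M))) (≈-trans (const-cong (∼-reflexive (rec M))) (const-+ _ _))

theta : ℕ → (ℕ → ℤ) → PowerSeries
theta N w = ∑[ k < N ] (const (w k) · q^ △ (suc k))

quadraticProduct : ℤ → ℕ → PowerSeries
quadraticProduct t zero    = # 1
quadraticProduct t (suc n) = (# 1 ⊕ const t · q^ suc n ⊕ q^ suc n · q^ suc n) · quadraticProduct t n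

gauss≈0 : ∀ {N} n m → N ≤ m → gauss n m ≈[ N ] # 0
gauss≈0 n m N≤m = ≈-trans (·-congʳ (≈-trans (·-congʳ (≈-trans (·-congʳ (q^≈0 (ℕ.≤-trans N≤m (m≤△[1+m] m)))) (·-zeroˡ _))) (·-zeroˡ _))) (·-zeroˡ _)

-- For t = z + 1/z the weights are u m = (z^{m+1} + z^{-m}) / (1 + z): this is the finite triple product with
-- the terms of z^{m+1} and z^{-m} paired and 1 + z divided out.
finite-triple-product : ∀ {N} t u → u 0 ≡ 1ℤ → (∀ m → t ℤ.* u m ≡ u (suc m) ℤ.+ prev u m) → ∀ n →
  ∑[ m < suc N ] (const (u m) · gauss n m) ≈[ N ] quadraticProduct t n
finite-triple-product {N} t u u0 rec zero = begin
  ∑[ m < suc N ] (const (u m) · gauss 0 m)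
    ≈⟨ ∑-head N _ ⟩
  const (u 0) · gauss 0 0 ⊕ ∑[ m < N ] (const (u (suc m)) · gauss 0 (suc m))
    ≈⟨ ⊕-cong (·-cong (SeriesEq.reflexive (cong const u0)) first) (∑-zero N λ m _ → rest m) ⟩
  # 1 · # 1 ⊕ # 0
    ≈⟨ solve 0 (con 1 :* con 1 :+ con 0 := con 1) ≈-refl ⟩
  # 1 ∎
  where
  open Solver N
  open ≈-Reasoning N
  first : gauss 0 0 ≈[ N ] # 1
  first = begin
    q^ 0 · euler 1 · euler⁻¹ 0 · euler⁻¹ 1   ≈⟨ ·-congʳ (·-cong (·-congʳ (SeriesEq.reflexive q^0)) euler⁻¹-zero) ⟩
    # 1 · euler 1 · # 1 · euler⁻¹ 1          ≈⟨ solve 2 (λ a b → con 1 :* a :* con 1 :* b := a :* b) ≈-refl (euler 1) (euler⁻¹ 1) ⟩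
    euler 1 · euler⁻¹ 1                      ≈⟨ euler-inverse 1 ⟩
    # 1                                      ∎
  rest : ∀ m → const (u (suc m)) · gauss 0 (suc m) ≈[ N ] # 0
  rest m rewrite ℕ.0∸n≡0 m = solve 3 (λ a b c → a :* (b :* con 0 :* c) := con 0) ≈-refl
    (const (u (suc m))) (q^ △ (suc (suc m)) · euler 1) (euler⁻¹ (suc (suc m)))
finite-triple-product {N} t u u0 rec (suc n) = begin
  ∑[ m < suc N ] (const (u m) · gauss (suc n) m)
    ≈⟨ ∑-cong (suc N) (λ m _ → ≈-trans (·-congˡ (gauss-suc n m))
         (solve 4 (λ u X a b → u :* ((con 1 :+ X :* X) :* a :+ X :* b) := (con 1 :+ X :* X) :* (u :* a) :+ X :* (u :* b)) ≈-refl
           (const (u m)) X (gauss n m) (gauss n (suc m) ⊕ prev (gauss n) m))) ⟩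
  ∑[ m < suc N ] ((# 1 ⊕ X · X) · (const (u m) · gauss n m) ⊕ X · (const (u m) · (gauss n (suc m) ⊕ prev (gauss n) m)))
    ≈⟨ ≈-trans (∑-⊕ (suc N) _ _) (⊕-cong (≈-sym (∑-·ˡ (suc N) _ _)) (≈-sym (∑-·ˡ (suc N) _ _))) ⟩
  (# 1 ⊕ X · X) · S ⊕ X · ∑[ m < suc N ] (const (u m) · (gauss n (suc m) ⊕ prev (gauss n) m))
    ≈⟨ ⊕-cong ≈-refl (·-congˡ (∑-by-parts t u (gauss n) rec (suc N))) ⟩
  (# 1 ⊕ X · X) · S ⊕ X · (const t · S ⊕ (const (prev u (suc N)) · gauss n (suc N) ⊖ const (u (suc N)) · gauss n N))
    -- The sum has one term more than the precision, so both boundary terms, of index N + 1 and N,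
    -- vanish modulo q^N.
    ≈⟨ ⊕-cong ≈-refl (·-congˡ (⊕-cong ≈-refl (⊕-cong (·-congˡ (gauss≈0 n (suc N) (ℕ.n≤1+n N)))
         (neg-cong (·-congˡ (gauss≈0 n N ℕ.≤-refl)))))) ⟩
  (# 1 ⊕ X · X) · S ⊕ X · (const t · S ⊕ (const (prev u (suc N)) · # 0 ⊖ const (u (suc N)) · # 0))
    ≈⟨ solve 5 (λ X t S a b → (con 1 :+ X :* X) :* S :+ X :* (t :* S :+ (a :* con 0 :- b :* con 0))
         := (con 1 :+ t :* X :+ X :* X) :* S) ≈-refl X (const t) S (const (prev u (suc N))) (const (u (suc N))) ⟩
  (# 1 ⊕ const t · X ⊕ X · X) · S
    ≈⟨ ·-congˡ (finite-triple-product t u u0 rec n) ⟩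
  quadraticProduct t (suc n) ∎
  where
  X = q^ suc n
  S = ∑[ m < suc N ] (const (u m) · gauss n m)
  open Solver N
  open ≈-Reasoning N

-- Passage to the limit

stable : ∀ {N M} (f : ℕ → PowerSeries) → (∀ j → M ≤ j → f (suc j) ≈[ N ] f j) → ∀ {j} → M ≤ j → f j ≈[ N ] f M
stable {N} {M} f step {j} M≤j = subst (λ j → f j ≈[ N ] f M) (ℕ.m+[n∸m]≡n M≤j) (from (j ∸ M))
  where
  from : ∀ i → f (M + i) ≈[ N ] f M
  from zero    = SeriesEq.reflexive (cong f (ℕ.+-identityʳ M))
  from (suc i) = ≈-trans (SeriesEq.reflexive (cong f (ℕ.+-suc M i))) (≈-trans (step (M + i) (ℕ.m≤m+n M i)) (from i))

module _ (M : ℕ) where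
  private
    N = suc M
    open Solver N
    open ≈-Reasoning N

  euler-stable : ∀ {j} → M ≤ j → euler j ≈[ suc M ] euler M
  euler-stable = stable euler λ j M≤j → ≈-trans (·-congˡ (⊕-cong ≈-refl (neg-cong (q^≈0 (s≤s M≤j)))))
    (solve 1 (λ e → e :* (con 1 :- con 0) := e) ≈-refl (euler j))

  euler⁻¹-stable : ∀ {j} → M ≤ j → euler⁻¹ j ≈[ suc M ] euler⁻¹ M
  euler⁻¹-stable = stable euler⁻¹ λ j M≤j → ≈-trans
    (solve 1 (λ e → e := (con 1 :- con 0) :* e) ≈-refl (euler⁻¹ (suc j)))
    (≈-trans (·-congʳ (⊕-cong ≈-refl (neg-cong (≈-sym (q^≈0 (s≤s M≤j)))))) (euler⁻¹-suc j))

  quadraticProduct-stable : ∀ t {j} → M ≤ j → quadraticProduct t j ≈[ suc M ] quadraticProduct t M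
  quadraticProduct-stable t = stable (quadraticProduct t) λ j M≤j → ≈-trans
    (·-congʳ (⊕-cong (⊕-cong ≈-refl (·-congˡ (q^≈0 (s≤s M≤j)))) (·-cong (q^≈0 (s≤s M≤j)) (q^≈0 (s≤s M≤j)))))
    (solve 2 (λ t e → (con 1 :+ t :* con 0 :+ con 0 :* con 0) :* e := e) ≈-refl (const t) (quadraticProduct t j))

  -- The choice n = 2M keeps n - m ≥ M for all m ≤ M, so every finite product here already has its
  -- limiting value to precision M + 1.
  gauss-limit : ∀ m → m < suc M → gauss (M + M) m ≈[ suc M ] q^ △ (suc m) · euler⁻¹ M
  gauss-limit m m<N = begin
    Q · euler (suc (M + M + (M + M))) · euler⁻¹-pred (suc (M + M) ∸ m) · euler⁻¹ (suc (M + M + m))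
      ≈⟨ ·-cong (·-cong (·-congˡ (euler-stable big₁)) (SeriesEq.reflexive (cong euler⁻¹-pred (ℕ.+-∸-assoc 1 (ℕ.≤-trans (s≤s⁻¹ m<N) (ℕ.m≤m+n M M))))))
           (euler⁻¹-stable big₂) ⟩
    Q · euler M · euler⁻¹ (M + M ∸ m) · euler⁻¹ M
      ≈⟨ ·-congʳ (·-congˡ (euler⁻¹-stable big₃)) ⟩
    Q · euler M · euler⁻¹ M · euler⁻¹ M
      ≈⟨ solve 3 (λ q p i → q :* p :* i :* i := q :* (p :* i) :* i) ≈-refl Q (euler M) (euler⁻¹ M) ⟩
    Q · (euler M · euler⁻¹ M) · euler⁻¹ M
      ≈⟨ ·-congʳ (·-congˡ (euler-inverse M)) ⟩
    Q · # 1 · euler⁻¹ M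
      ≈⟨ solve 2 (λ q i → q :* con 1 :* i := q :* i) ≈-refl Q (euler⁻¹ M) ⟩
    Q · euler⁻¹ M ∎
    where
    Q = q^ △ (suc m)
    big₁ : M ≤ suc (M + M + (M + M))
    big₁ = ℕ.m≤n⇒m≤1+n (ℕ.≤-trans (ℕ.m≤m+n M M) (ℕ.m≤m+n (M + M) (M + M)))
    big₂ : M ≤ suc (M + M + m)
    big₂ = ℕ.m≤n⇒m≤1+n (ℕ.≤-trans (ℕ.m≤m+n M M) (ℕ.m≤m+n (M + M) m))
    big₃ : M ≤ M + M ∸ m
    big₃ = subst (M ≤_) (≡.sym (ℕ.+-∸-assoc M (s≤s⁻¹ m<N))) (ℕ.m≤m+n M (M ∸ m))

  triple-product : ∀ t u → u 0 ≡ 1ℤ → (∀ m → t ℤ.* u m ≡ u (suc m) ℤ.+ prev u m) →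
    euler M · quadraticProduct t M ≈[ suc M ] theta (suc M) u
  triple-product t u u0 rec = begin
    euler M · quadraticProduct t M
      ≈⟨ ·-congˡ (≈-trans (≈-sym (quadraticProduct-stable t (ℕ.m≤m+n M M))) (≈-sym (finite-triple-product t u u0 rec (M + M)))) ⟩
    euler M · (∑[ m < N ] (const (u m) · gauss (M + M) m) ⊕ const (u N) · gauss (M + M) N)
      ≈⟨ ·-congˡ (⊕-cong (∑-cong N λ m m<N → ≈-trans (·-congˡ (gauss-limit m m<N)) (≈-sym (·-assoc _ _ _)))
           (·-congˡ (gauss≈0 (M + M) N ℕ.≤-refl))) ⟩
    euler M · (∑[ m < N ] (const (u m) · q^ △ (suc m) · euler⁻¹ M) ⊕ const (u N) · # 0)
      ≈⟨ ·-congˡ (⊕-cong (∑-·ʳ N (euler⁻¹ M) _) ≈-refl) ⟨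
    euler M · (theta N u · euler⁻¹ M ⊕ const (u N) · # 0)
      ≈⟨ solve 4 (λ p i t u → p :* (t :* i :+ u :* con 0) := p :* i :* t) ≈-refl (euler M) (euler⁻¹ M) (theta N u) (const (u N)) ⟩
    euler M · euler⁻¹ M · theta N u
      ≈⟨ ≈-trans (·-congʳ (euler-inverse M)) (·-identityˡ _) ⟩
    theta N u ∎

-- The cases z = -1 (Jacobi) and z = 1 (Gauss)

sgn : ℕ → ℤ
sgn zero    = 1ℤ
sgn (suc k) = ℤ.- sgn k

signedOdd : ℕ → ℤ
signedOdd k = sgn k ℤ.* (1ℤ ℤ.+ + 2 ℤ.* + k)

plusProduct : ℕ → PowerSeries
plusProduct zero    = # 1
plusProduct (suc n) = plusProduct n · (# 1 ⊕ q^ suc n)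

euler² : ∀ {N} n → quadraticProduct (ℤ.- + 2) n ≈[ N ] euler n · euler n
euler² {N} zero = solve 0 (con 1 := con 1 :* con 1) ≈-refl
  where open Solver N
euler² {N} (suc n) = ≈-trans (·-cong (⊕-cong (⊕-cong ≈-refl (·-congʳ (const-neg (+ 2)))) ≈-refl) (euler² n))
  (solve 2 (λ X e → (con 1 :+ :- con 2 :* X :+ X :* X) :* (e :* e) := e :* (con 1 :- X) :* (e :* (con 1 :- X))) ≈-refl (q^ suc n) (euler n))
  where open Solver N

plusProduct² : ∀ {N} n → quadraticProduct (+ 2) n ≈[ N ] plusProduct n · plusProduct n
plusProduct² {N} zero = solve 0 (con 1 := con 1 :* con 1) ≈-refl
  where open Solver N
plusProduct² {N} (suc n) = ≈-trans (·-congˡ (plusProduct² n))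
  (solve 2 (λ X e → (con 1 :+ con 2 :* X :+ X :* X) :* (e :* e) := e :* (con 1 :+ X) :* (e :* (con 1 :+ X))) ≈-refl (q^ suc n) (plusProduct n))
  where open Solver N

euler·plusProduct : ∀ {N} n → euler n · plusProduct n ≈[ N ] dilate 1 (euler n)
euler·plusProduct zero = ≈-trans (·-identityˡ _) (≈-sym (dilate-const 1 (+ 1)))
euler·plusProduct {N} (suc n) = begin
  euler n · (# 1 ⊖ X) · (plusProduct n · (# 1 ⊕ X))
    ≈⟨ solve 3 (λ X e p → e :* (con 1 :- X) :* (p :* (con 1 :+ X)) := e :* p :* (con 1 :- X :* X)) ≈-refl X (euler n) (plusProduct n) ⟩
  euler n · plusProduct n · (# 1 ⊖ X · X)
    ≈⟨ ·-cong (euler·plusProduct n) (⊕-cong ≈-refl (neg-cong (≈-sym (≈-trans (SeriesEq.reflexive (cong q^_ (double (suc n)))) (q^-+ (suc n) (suc n)))))) ⟩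
  dilate 1 (euler n) · (# 1 ⊖ q^ (suc n * 2))
    ≈⟨ dilate-euler-suc n ⟨
  dilate 1 (euler (suc n)) ∎
  where
  X = q^ suc n
  open Solver N
  open ≈-Reasoning N
  double : ∀ n → n * 2 ≡ n + n
  double = ℕ-Solver.solve-∀

signedOdd-rec : ∀ m → (ℤ.- + 2) ℤ.* signedOdd m ≡ signedOdd (suc m) ℤ.+ prev signedOdd m
signedOdd-rec zero    = refl
signedOdd-rec (suc m) = lem (sgn m) (+ m)
  where
  lem : ∀ s m → (ℤ.- + 2) ℤ.* (ℤ.- s ℤ.* (1ℤ ℤ.+ + 2 ℤ.* (1ℤ ℤ.+ m)))
    ≡ ℤ.- (ℤ.- s) ℤ.* (1ℤ ℤ.+ + 2 ℤ.* (1ℤ ℤ.+ (1ℤ ℤ.+ m))) ℤ.+ s ℤ.* (1ℤ ℤ.+ + 2 ℤ.* m)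
  lem = solve-∀

jacobi-cube : ∀ M → euler M · euler M · euler M ≈[ suc M ] theta (suc M) signedOdd
jacobi-cube M = ≈-trans (≈-trans (·-assoc _ _ _) (·-congˡ (≈-sym (euler² M)))) (triple-product M (ℤ.- + 2) signedOdd refl signedOdd-rec)

gauss-triangular : ∀ M → euler M · theta (suc M) (λ _ → 1ℤ) ≈[ suc M ] dilate 1 (euler M) · dilate 1 (euler M)
gauss-triangular M = begin
  euler M · theta (suc M) (λ _ → 1ℤ)
    ≈⟨ ·-congˡ (triple-product M (+ 2) (λ _ → 1ℤ) refl λ { zero → refl ; (suc _) → refl }) ⟨
  euler M · (euler M · quadraticProduct (+ 2) M)
    ≈⟨ ·-congˡ (·-congˡ (plusProduct² M)) ⟩
  euler M · (euler M · (plusProduct M · plusProduct M))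
    ≈⟨ solve 2 (λ e p → e :* (e :* (p :* p)) := e :* p :* (e :* p)) ≈-refl (euler M) (plusProduct M) ⟩
  euler M · plusProduct M · (euler M · plusProduct M)
    ≈⟨ ·-cong (euler·plusProduct M) (euler·plusProduct M) ⟩
  dilate 1 (euler M) · dilate 1 (euler M) ∎
  where
  open Solver (suc M)
  open ≈-Reasoning (suc M)

-- The lattice of odd integers

sgn² : ∀ k → sgn k ℤ.* sgn k ≡ 1ℤ
sgn² zero    = refl
sgn² (suc k) = ≡.trans (lem (sgn k)) (sgn² k)
  where
  lem : ∀ s → ℤ.- s ℤ.* ℤ.- s ≡ s ℤ.* s
  lem = solve-∀

sgn-double : ∀ m → sgn (m + m) ≡ 1ℤ
sgn-double zero    = refl
sgn-double (suc m) = ≡.trans (cong (λ z → ℤ.- sgn z) (ℕ.+-suc m m)) (≡.trans (ℤ.neg-involutive _) (sgn-double m))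

signedOdd² : ∀ k → signedOdd k ℤ.* signedOdd k ≡ + 8 ℤ.* + △ (suc k) ℤ.+ 1ℤ
signedOdd² k = ≡.trans (lem₁ (sgn k) (+ k)) (≡.trans (cong (ℤ._* ((1ℤ ℤ.+ + 2 ℤ.* + k) ℤ.* (1ℤ ℤ.+ + 2 ℤ.* + k))) (sgn² k))
  (≡.trans (lem₂ (+ k)) (≡.trans (cong (λ z → + 4 ℤ.* z ℤ.+ 1ℤ) (≡.sym (double△ k))) (lem₄ (+ △ (suc k))))))
  where
  lem₁ : ∀ s k → s ℤ.* (1ℤ ℤ.+ + 2 ℤ.* k) ℤ.* (s ℤ.* (1ℤ ℤ.+ + 2 ℤ.* k))
    ≡ s ℤ.* s ℤ.* ((1ℤ ℤ.+ + 2 ℤ.* k) ℤ.* (1ℤ ℤ.+ + 2 ℤ.* k))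
  lem₁ = solve-∀
  lem₂ : ∀ k → 1ℤ ℤ.* ((1ℤ ℤ.+ + 2 ℤ.* k) ℤ.* (1ℤ ℤ.+ + 2 ℤ.* k)) ≡ + 4 ℤ.* (k ℤ.* (1ℤ ℤ.+ k)) ℤ.+ 1ℤ
  lem₂ = solve-∀
  lem₃ : ∀ t k → + 2 ℤ.* (t ℤ.+ (1ℤ ℤ.+ k)) ≡ + 2 ℤ.* t ℤ.+ + 2 ℤ.* (1ℤ ℤ.+ k)
  lem₃ = solve-∀
  lem₄ : ∀ t → + 4 ℤ.* (+ 2 ℤ.* t) ℤ.+ 1ℤ ≡ + 8 ℤ.* t ℤ.+ 1ℤ
  lem₄ = solve-∀
  lem₅ : ∀ k → k ℤ.* (1ℤ ℤ.+ k) ℤ.+ + 2 ℤ.* (1ℤ ℤ.+ k) ≡ (1ℤ ℤ.+ k) ℤ.* (1ℤ ℤ.+ (1ℤ ℤ.+ k))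
  lem₅ = solve-∀
  double△ : ∀ k → + 2 ℤ.* + △ (suc k) ≡ + k ℤ.* (1ℤ ℤ.+ + k)
  double△ zero    = refl
  double△ (suc k) = ≡.trans (lem₃ (+ △ (suc k)) (+ k)) (≡.trans (cong (ℤ._+ + 2 ℤ.* (1ℤ ℤ.+ + k)) (double△ k)) (lem₅ (+ k)))

∣sgn∣ : ∀ k → ℤ.∣ sgn k ∣ ≡ 1
∣sgn∣ zero    = refl
∣sgn∣ (suc k) = ≡.trans (ℤ.∣-i∣≡∣i∣ (sgn k)) (∣sgn∣ k)

signedOdd-injective : ∀ k l → signedOdd k ≡ signedOdd l → k ≡ l
signedOdd-injective k l eq = ℕ.*-cancelˡ-≡ k l 2 (ℕ.suc-injective (≡.trans (≡.sym (abs k)) (≡.trans (cong ℤ.∣_∣ eq) (abs l))))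
  where
  abs : ∀ k → ℤ.∣ signedOdd k ∣ ≡ suc (2 * k)
  abs k = ≡.trans (ℤ.abs-* (sgn k) (1ℤ ℤ.+ + 2 ℤ.* + k)) (≡.trans (cong₂ _*_ (∣sgn∣ k) (cong (λ z → ℤ.∣ 1ℤ ℤ.+ z ∣) (≡.sym (ℤ.pos-* 2 k)))) (ℕ.*-identityˡ _))

signedOdd≡1[4] : ∀ k → ∃[ y ] signedOdd k ≡ + 4 ℤ.* y ℤ.+ 1ℤ
signedOdd≡1[4] zero          = 0ℤ , refl
signedOdd≡1[4] (suc zero)    = -[1+ 0 ] , refl
signedOdd≡1[4] (suc (suc k)) with y , eq ← signedOdd≡1[4] k =
  y ℤ.+ sgn k , ≡.trans (lem₁ (sgn k) (+ k)) (≡.trans (cong (ℤ._+ + 4 ℤ.* sgn k) eq) (lem₂ y (sgn k)))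
  where
  lem₁ : ∀ s k → ℤ.- (ℤ.- s) ℤ.* (1ℤ ℤ.+ + 2 ℤ.* (1ℤ ℤ.+ (1ℤ ℤ.+ k))) ≡ s ℤ.* (1ℤ ℤ.+ + 2 ℤ.* k) ℤ.+ + 4 ℤ.* s
  lem₁ = solve-∀
  lem₂ : ∀ y s → + 4 ℤ.* y ℤ.+ 1ℤ ℤ.+ + 4 ℤ.* s ≡ + 4 ℤ.* (y ℤ.+ s) ℤ.+ 1ℤ
  lem₂ = solve-∀

1[4]-signedOdd : ∀ y → ∃[ k ] signedOdd k ≡ + 4 ℤ.* y ℤ.+ 1ℤ
1[4]-signedOdd (+ m) = m + m , ≡.trans (cong (ℤ._* (1ℤ ℤ.+ + 2 ℤ.* (+ m ℤ.+ + m))) (sgn-double m)) (lem (+ m))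
  where
  lem : ∀ m → 1ℤ ℤ.* (1ℤ ℤ.+ + 2 ℤ.* (m ℤ.+ m)) ≡ + 4 ℤ.* m ℤ.+ 1ℤ
  lem = solve-∀
1[4]-signedOdd -[1+ j ] = suc (j + j) ,
  ≡.trans (cong (λ s → ℤ.- s ℤ.* (1ℤ ℤ.+ + 2 ℤ.* (1ℤ ℤ.+ (+ j ℤ.+ + j)))) (sgn-double j)) (lem (+ j))
  where
  lem : ∀ j → ℤ.- 1ℤ ℤ.* (1ℤ ℤ.+ + 2 ℤ.* (1ℤ ℤ.+ (j ℤ.+ j))) ≡ + 4 ℤ.* (ℤ.- (1ℤ ℤ.+ j)) ℤ.+ 1ℤ
  lem = solve-∀

-- Multiplication by -(1 + 2i) in ℤ[i] is (s , t) ↦ (2t - s , -2s - t). It preserves the condition that both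
-- coordinates are ≡ 1 mod 4, and multiplies the norm by 5; its image there is the set of (x , z) with z ≡ 2x mod 5.
opaque
  rotate₁ : ∀ k l → ∃[ m ] signedOdd m ≡ + 2 ℤ.* signedOdd l ℤ.- signedOdd k
  rotate₁ k l with i , p ← signedOdd≡1[4] k with j , r ← signedOdd≡1[4] l with m , eq ← 1[4]-signedOdd (+ 2 ℤ.* j ℤ.- i) =
    m , ≡.trans eq (≡.trans (lem i j) (cong₂ (λ x z → + 2 ℤ.* z ℤ.- x) (≡.sym p) (≡.sym r)))
    where
    lem : ∀ i j → + 4 ℤ.* (+ 2 ℤ.* j ℤ.- i) ℤ.+ 1ℤ ≡ + 2 ℤ.* (+ 4 ℤ.* j ℤ.+ 1ℤ) ℤ.- (+ 4 ℤ.* i ℤ.+ 1ℤ)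
    lem = solve-∀

  rotate₂ : ∀ k l → ∃[ m ] signedOdd m ≡ ℤ.- (+ 2 ℤ.* signedOdd k) ℤ.- signedOdd l
  rotate₂ k l with i , p ← signedOdd≡1[4] k with j , r ← signedOdd≡1[4] l with m , eq ← 1[4]-signedOdd (ℤ.- (+ 2 ℤ.* i) ℤ.- j ℤ.- 1ℤ) =
    m , ≡.trans eq (≡.trans (lem i j) (cong₂ (λ x z → ℤ.- (+ 2 ℤ.* x) ℤ.- z) (≡.sym p) (≡.sym r)))
    where
    lem : ∀ i j → + 4 ℤ.* (ℤ.- (+ 2 ℤ.* i) ℤ.- j ℤ.- 1ℤ) ℤ.+ 1ℤ ≡ ℤ.- (+ 2 ℤ.* (+ 4 ℤ.* i ℤ.+ 1ℤ)) ℤ.- (+ 4 ℤ.* j ℤ.+ 1ℤ)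
    lem = solve-∀

rot₁ rot₂ : ℕ → ℕ → ℕ
rot₁ k l = proj₁ (rotate₁ k l)
rot₂ k l = proj₁ (rotate₂ k l)

-- Multiplying the image by the conjugate -(1 - 2i) gives back 5 (s , t).
rot-injective : ∀ {k l k′ l′} → rot₁ k l ≡ rot₁ k′ l′ → rot₂ k l ≡ rot₂ k′ l′ → k ≡ k′ × l ≡ l′
rot-injective {k} {l} {k′} {l′} p r = signedOdd-injective k k′ (ℤ.*-cancelˡ-≡ (+ 5) s s′ (≡.trans (lem₁ s t) (≡.trans (cong₂ (λ x z → ℤ.- x ℤ.- + 2 ℤ.* z) xs zs) (≡.sym (lem₁ s′ t′)))))
                                    , signedOdd-injective l l′ (ℤ.*-cancelˡ-≡ (+ 5) t t′ (≡.trans (lem₂ s t) (≡.trans (cong₂ (λ x z → + 2 ℤ.* x ℤ.- z) xs zs) (≡.sym (lem₂ s′ t′)))))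
  where
  s = signedOdd k
  t = signedOdd l
  s′ = signedOdd k′
  t′ = signedOdd l′
  xs : + 2 ℤ.* t ℤ.- s ≡ + 2 ℤ.* t′ ℤ.- s′
  xs = ≡.trans (≡.sym (proj₂ (rotate₁ k l))) (≡.trans (cong signedOdd p) (proj₂ (rotate₁ k′ l′)))
  zs : ℤ.- (+ 2 ℤ.* s) ℤ.- t ≡ ℤ.- (+ 2 ℤ.* s′) ℤ.- t′
  zs = ≡.trans (≡.sym (proj₂ (rotate₂ k l))) (≡.trans (cong signedOdd r) (proj₂ (rotate₂ k′ l′)))
  lem₁ : ∀ s t → + 5 ℤ.* s ≡ ℤ.- (+ 2 ℤ.* t ℤ.- s) ℤ.- + 2 ℤ.* (ℤ.- (+ 2 ℤ.* s) ℤ.- t)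
  lem₁ = solve-∀
  lem₂ : ∀ s t → + 5 ℤ.* t ≡ + 2 ℤ.* (+ 2 ℤ.* t ℤ.- s) ℤ.- (ℤ.- (+ 2 ℤ.* s) ℤ.- t)
  lem₂ = solve-∀

-- The relation x² + z² = 5 (s² + t²), read through x² = 8 △ + 1. The constant (10 - 2)/8 = 1 is the
-- source of the factor q in the rotation identities.
rot-△ : ∀ k l → △ (suc (rot₁ k l)) + △ (suc (rot₂ k l)) ≡ 1 + (△ (suc k) + △ (suc l)) * 5
rot-△ k l = ℤ.+-injective (ℤ.*-cancelˡ-≡ (+ 8) (+ (A + B)) (+ (1 + (C + D) * 5)) (begin
  + 8 ℤ.* (+ A ℤ.+ + B)                                  ≡⟨ lem₁ (+ A) (+ B) ⟩
  (+ 8 ℤ.* + A ℤ.+ 1ℤ) ℤ.+ (+ 8 ℤ.* + B ℤ.+ 1ℤ) ℤ.- + 2  ≡⟨ cong₂ (λ x z → x ℤ.+ z ℤ.- + 2) (square (rot₁ k l) (proj₂ (rotate₁ k l))) (square (rot₂ k l) (proj₂ (rotate₂ k l))) ⟨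
  x ℤ.* x ℤ.+ z ℤ.* z ℤ.- + 2                            ≡⟨ lem₂ s t ⟩
  + 5 ℤ.* (s ℤ.* s ℤ.+ t ℤ.* t) ℤ.- + 2                  ≡⟨ cong₂ (λ x z → + 5 ℤ.* (x ℤ.+ z) ℤ.- + 2) (signedOdd² k) (signedOdd² l) ⟩
  + 5 ℤ.* ((+ 8 ℤ.* + C ℤ.+ 1ℤ) ℤ.+ (+ 8 ℤ.* + D ℤ.+ 1ℤ)) ℤ.- + 2  ≡⟨ lem₃ (+ C) (+ D) ⟩
  + 8 ℤ.* (1ℤ ℤ.+ (+ C ℤ.+ + D) ℤ.* + 5)                 ≡⟨ cong (λ z → + 8 ℤ.* (1ℤ ℤ.+ z)) (ℤ.pos-* (C + D) 5) ⟨
  + 8 ℤ.* + (1 + (C + D) * 5)                            ∎))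
  where
  open ≡-Reasoning
  A = △ (suc (rot₁ k l))
  B = △ (suc (rot₂ k l))
  C = △ (suc k)
  D = △ (suc l)
  s = signedOdd k
  t = signedOdd l
  x = + 2 ℤ.* t ℤ.- s
  z = ℤ.- (+ 2 ℤ.* s) ℤ.- t
  square : ∀ m {y} → signedOdd m ≡ y → y ℤ.* y ≡ + 8 ℤ.* + △ (suc m) ℤ.+ 1ℤ
  square m refl = signedOdd² m
  lem₁ : ∀ a b → + 8 ℤ.* (a ℤ.+ b) ≡ (+ 8 ℤ.* a ℤ.+ 1ℤ) ℤ.+ (+ 8 ℤ.* b ℤ.+ 1ℤ) ℤ.- + 2
  lem₁ = solve-∀
  lem₂ : ∀ s t → (+ 2 ℤ.* t ℤ.- s) ℤ.* (+ 2 ℤ.* t ℤ.- s) ℤ.+ (ℤ.- (+ 2 ℤ.* s) ℤ.- t) ℤ.* (ℤ.- (+ 2 ℤ.* s) ℤ.- t) ℤ.- + 2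
    ≡ + 5 ℤ.* (s ℤ.* s ℤ.+ t ℤ.* t) ℤ.- + 2
  lem₂ = solve-∀
  lem₃ : ∀ c d → + 5 ℤ.* ((+ 8 ℤ.* c ℤ.+ 1ℤ) ℤ.+ (+ 8 ℤ.* d ℤ.+ 1ℤ)) ℤ.- + 2 ≡ + 8 ℤ.* (1ℤ ℤ.+ (c ℤ.+ d) ℤ.* + 5)
  lem₃ = solve-∀

rot-surjective : ∀ m n → + 5 ∣.∣ (signedOdd n ℤ.- + 2 ℤ.* signedOdd m) → ∃[ k ] ∃[ l ] rot₁ k l ≡ m × rot₂ k l ≡ n
rot-surjective m n (divides q eq) with i , p ← signedOdd≡1[4] m with j , r ← signedOdd≡1[4] n =
  k , l , signedOdd-injective (rot₁ k l) m (≡.trans (proj₂ (rotate₁ k l)) (≡.trans (cong₂ (λ s t → + 2 ℤ.* t ℤ.- s) ks ls) (≡.trans (lem₁ i c) (≡.sym p))))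
        , signedOdd-injective (rot₂ k l) n (≡.trans (proj₂ (rotate₂ k l)) (≡.trans (cong₂ (λ s t → ℤ.- (+ 2 ℤ.* s) ℤ.- t) ks ls) (≡.trans (lem₂ i c) (≡.trans (cong (λ z → + 4 ℤ.* z ℤ.+ 1ℤ) j≡) (≡.sym r)))))
  where
  -- From z - 2x = 5q with x = 4i + 1 and z = 4j + 1, this is (q + 1)/4 written without division.
  -- The preimage is t = -q = 1 - 4c and s = -(x + 2q) = 4(-i - 2c) + 1.
  c = j ℤ.- + 2 ℤ.* i ℤ.- q
  kΣ = 1[4]-signedOdd (ℤ.- i ℤ.- + 2 ℤ.* c)
  lΣ = 1[4]-signedOdd (ℤ.- c)
  k = proj₁ kΣ
  l = proj₁ lΣ
  ks = proj₂ kΣ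
  ls = proj₂ lΣ
  lem₁ : ∀ i c → + 2 ℤ.* (+ 4 ℤ.* (ℤ.- c) ℤ.+ 1ℤ) ℤ.- (+ 4 ℤ.* (ℤ.- i ℤ.- + 2 ℤ.* c) ℤ.+ 1ℤ) ≡ + 4 ℤ.* i ℤ.+ 1ℤ
  lem₁ = solve-∀
  lem₂ : ∀ i c → ℤ.- (+ 2 ℤ.* (+ 4 ℤ.* (ℤ.- i ℤ.- + 2 ℤ.* c) ℤ.+ 1ℤ)) ℤ.- (+ 4 ℤ.* (ℤ.- c) ℤ.+ 1ℤ) ≡ + 4 ℤ.* (+ 2 ℤ.* i ℤ.- 1ℤ ℤ.+ + 5 ℤ.* c) ℤ.+ 1ℤ
  lem₂ = solve-∀
  lem₃ : ∀ i j q → + 2 ℤ.* i ℤ.- 1ℤ ℤ.+ + 5 ℤ.* (j ℤ.- + 2 ℤ.* i ℤ.- q) ≡ j ℤ.+ ((+ 4 ℤ.* j ℤ.+ 1ℤ) ℤ.- + 2 ℤ.* (+ 4 ℤ.* i ℤ.+ 1ℤ) ℤ.- q ℤ.* + 5)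
  lem₃ = solve-∀
  eq′ : (+ 4 ℤ.* j ℤ.+ 1ℤ) ℤ.- + 2 ℤ.* (+ 4 ℤ.* i ℤ.+ 1ℤ) ≡ q ℤ.* + 5
  eq′ = ≡.trans (cong₂ (λ z x → z ℤ.- + 2 ℤ.* x) (≡.sym r) (≡.sym p)) eq
  j≡ : + 2 ℤ.* i ℤ.- 1ℤ ℤ.+ + 5 ℤ.* c ≡ j
  j≡ = ≡.trans (lem₃ i j q) (≡.trans (cong (λ z → j ℤ.+ (z ℤ.- q ℤ.* + 5)) eq′) (≡.trans (cong (λ z → j ℤ.+ z) (ℤ.+-inverseʳ (q ℤ.* + 5))) (ℤ.+-identityʳ j)))

-- Lattice sums

∑-single : ∀ {N f} n k₀ → k₀ < n → (∀ k → k ≢ k₀ → f k ≈[ N ] # 0) → ∑ n f ≈[ N ] f k₀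
∑-single {N} {f} (suc n) k₀ k₀<n p with k₀ ℕ.≟ n
... | yes refl = ≈-trans (⊕-cong (∑-zero n λ k k<n → p k (ℕ.<⇒≢ k<n)) ≈-refl) (⊕-identityˡ _)
... | no k₀≢n  = ≈-trans (⊕-cong (∑-single n k₀ (ℕ.≤∧≢⇒< (s≤s⁻¹ k₀<n) k₀≢n) p) (p n (k₀≢n ∘ ≡.sym))) (⊕-identityʳ _)

∑² : ℕ → (ℕ → ℕ → PowerSeries) → PowerSeries
∑² n f = ∑[ k < n ] ∑[ l < n ] f k l

∑²-cong : ∀ {N f g} n → (∀ k l → k < n → l < n → f k l ≈[ N ] g k l) → ∑² n f ≈[ N ] ∑² n g
∑²-cong n p = ∑-cong n λ k k<n → ∑-cong n λ l l<n → p k l k<n l<n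

∑²-zero : ∀ {N f} n → (∀ k l → k < n → l < n → f k l ≈[ N ] # 0) → ∑² n f ≈[ N ] # 0
∑²-zero n p = ∑-zero n λ k k<n → ∑-zero n λ l l<n → p k l k<n l<n

∑²-⊕ : ∀ {N} n f g → ∑² n (λ k l → f k l ⊕ g k l) ≈[ N ] ∑² n f ⊕ ∑² n g
∑²-⊕ n f g = ≈-trans (∑-cong n λ k _ → ∑-⊕ n (f k) (g k)) (∑-⊕ n _ _)

∑²-·ˡ : ∀ {N} n c f → c · ∑² n f ≈[ N ] ∑² n (λ k l → c · f k l)
∑²-·ˡ n c f = ≈-trans (∑-·ˡ n c _) (∑-cong n λ k _ → ∑-·ˡ n c (f k))

∑-·-∑ : ∀ {N} n f g → ∑ n f · ∑ n g ≈[ N ] ∑² n (λ k l → f k · g l)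
∑-·-∑ n f g = ≈-trans (∑-·ʳ n _ f) (∑-cong n λ k _ → ∑-·ˡ n (f k) g)

∑²-single : ∀ {N f} n k₀ l₀ → k₀ < n → l₀ < n → (∀ k l → ¬ (k ≡ k₀ × l ≡ l₀) → f k l ≈[ N ] # 0) → ∑² n f ≈[ N ] f k₀ l₀
∑²-single {f = f} n k₀ l₀ k₀<n l₀<n p = ≈-trans
  (∑-single n k₀ k₀<n λ k k≢k₀ → ∑-zero n λ l _ → p k l (k≢k₀ ∘ proj₁))
  (∑-single n l₀ l₀<n λ l l≢l₀ → p k₀ l (l≢l₀ ∘ proj₂))

∑²-swap : ∀ {N} m n (f : ℕ → ℕ → ℕ → ℕ → PowerSeries) →
  ∑² m (λ k l → ∑² n (f k l)) ≈[ N ] ∑² n (λ s t → ∑² m (λ k l → f k l s t))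
∑²-swap m n f = ≈-trans (∑-cong m λ k _ → ∑-swap m n λ l s → ∑[ t < n ] f k l s t)
  (≈-trans (∑-swap m n λ k s → ∑[ l < m ] ∑[ t < n ] f k l s t)
  (∑-cong n λ s _ → ≈-trans (∑-cong m λ k _ → ∑-swap m n λ l t → f k l s t) (∑-swap m n λ k t → ∑[ l < m ] f k l s t)))

dilate-∑ : ∀ {N} j n f → dilate j (∑ n f) ≈[ N ] ∑[ k < n ] dilate j (f k)
dilate-∑ j zero    f = dilate-const j 0ℤ
dilate-∑ j (suc n) f = ≈-trans (dilate-⊕ j _ _) (⊕-cong (dilate-∑ j n f) ≈-refl)

-- Polynomials in two variables: (c , i , j) stands for c x^i z^j.
Polynomial₂ : Set
Polynomial₂ = List (ℕ × ℕ × ℕ)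

evaluate : Polynomial₂ → ℤ → ℤ → ℤ
evaluate []                x z = 0ℤ
evaluate ((c , i , j) ∷ P) x z = + c ℤ.* (x ℤ.^ i ℤ.* z ℤ.^ j) ℤ.+ evaluate P x z

moment : ℕ → ℕ → PowerSeries
moment N i = theta N λ k → signedOdd k ℤ.^ i

evaluate-moments : ℕ → Polynomial₂ → PowerSeries
evaluate-moments N []                = # 0
evaluate-moments N ((c , i , j) ∷ P) = # c · (moment N i · moment N j) ⊕ evaluate-moments N P

norm : ℕ → ℕ → ℕ
norm k l = △ (suc k) + △ (suc l)

m≤norm : ∀ k l → k ≤ norm k l
m≤norm k l = ℕ.≤-trans (m≤△[1+m] k) (ℕ.m≤m+n (△ (suc k)) (△ (suc l)))

n≤norm : ∀ k l → l ≤ norm k l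
n≤norm k l = ℕ.≤-trans (m≤△[1+m] l) (ℕ.m≤n+m (△ (suc l)) (△ (suc k)))

latticeTerm : Polynomial₂ → ℕ → ℕ → PowerSeries
latticeTerm P k l = const (evaluate P (signedOdd k) (signedOdd l)) · q^ norm k l

-- A monomial weight x^i z^j separates the variables, so its double sum is the product m_i m_j.
lattice-sum : ∀ {N} n P → ∑² n (latticeTerm P) ≈[ N ] evaluate-moments n P
lattice-sum n [] = ∑²-zero n λ k l _ _ → ·-zeroˡ _
lattice-sum {N} n ((c , i , j) ∷ P) = begin
  ∑² n (latticeTerm ((c , i , j) ∷ P))
    ≈⟨ ∑²-cong n (λ k l _ _ → split k l) ⟩
  ∑² n (λ k l → # c · (m i k · m j l) ⊕ latticeTerm P k l)
    ≈⟨ ∑²-⊕ n _ _ ⟩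
  ∑² n (λ k l → # c · (m i k · m j l)) ⊕ ∑² n (latticeTerm P)
    ≈⟨ ⊕-cong (≈-trans (·-congˡ (∑-·-∑ n (m i) (m j))) (∑²-·ˡ n (# c) _)) (≈-sym (lattice-sum n P)) ⟨
  # c · (moment n i · moment n j) ⊕ evaluate-moments n P ∎
  where
  open Solver N
  open ≈-Reasoning N
  m : ℕ → ℕ → PowerSeries
  m i k = const (signedOdd k ℤ.^ i) · q^ △ (suc k)
  split : ∀ k l → latticeTerm ((c , i , j) ∷ P) k l ≈[ N ] # c · (m i k · m j l) ⊕ latticeTerm P k l
  split k l = begin
    const (+ c ℤ.* (xⁱ ℤ.* zʲ) ℤ.+ p) · q^ norm k l
      ≈⟨ ·-congʳ (≈-trans (const-+ _ p) (⊕-cong (≈-trans (const-· (+ c) _) (·-congˡ (const-· xⁱ zʲ))) ≈-refl)) ⟩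
    (# c · (const xⁱ · const zʲ) ⊕ const p) · q^ norm k l
      ≈⟨ SeriesEq.distribʳ _ _ _ ⟩
    # c · (const xⁱ · const zʲ) · q^ norm k l ⊕ latticeTerm P k l
      ≈⟨ ⊕-cong (·-congˡ (q^-+ (△ (suc k)) (△ (suc l)))) ≈-refl ⟩
    # c · (const xⁱ · const zʲ) · (q^ △ (suc k) · q^ △ (suc l)) ⊕ latticeTerm P k l
      ≈⟨ ⊕-cong (solve 5 (λ c x z a b → c :* (x :* z) :* (a :* b) := c :* (x :* a :* (z :* b))) ≈-refl
           (# c) (const xⁱ) (const zʲ) (q^ △ (suc k)) (q^ △ (suc l))) ≈-refl ⟩
    # c · (m i k · m j l) ⊕ latticeTerm P k l ∎
    where
    xⁱ = signedOdd k ℤ.^ i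
    zʲ = signedOdd l ℤ.^ j
    p = evaluate P (signedOdd k) (signedOdd l)

indicator : {A : Set} → Dec A → PowerSeries
indicator (yes _) = # 1
indicator (no _)  = # 0

latticeTerm≈0 : ∀ {N} P k l → N ≤ norm k l → latticeTerm P k l ≈[ N ] # 0
latticeTerm≈0 P k l N≤ = ≈-trans (·-congˡ (q^≈0 N≤)) (·-zeroʳ _)

-- The indicator of (rot₁ s t , rot₂ s t) = (k , l) is inserted and the order of summation exchanged.
lattice-rotation : ∀ N P R →
  (∀ x z → ¬ (+ 5 ∣.∣ (z ℤ.- + 2 ℤ.* x)) → evaluate P x z ∼ 0ℤ) →
  (∀ s t → evaluate P (+ 2 ℤ.* t ℤ.- s) (ℤ.- (+ 2 ℤ.* s) ℤ.- t) ∼ evaluate R s t) →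
  evaluate-moments N P ≈[ N ] q^ 1 · dilate 4 (evaluate-moments N R)
lattice-rotation N P R off on = begin
  evaluate-moments N P
    ≈⟨ lattice-sum N P ⟨
  ∑² N (latticeTerm P)
    ≈⟨ ∑²-cong N (λ k l _ _ → insert k l) ⟩
  ∑² N (λ k l → ∑² N (λ s t → graph k l s t))
    ≈⟨ ∑²-swap N N graph ⟩
  ∑² N (λ s t → ∑² N (λ k l → graph k l s t))
    ≈⟨ ∑²-cong N (λ s t _ _ → evaluate-graph s t) ⟩
  ∑² N (λ s t → q^ 1 · dilate 4 (latticeTerm R s t))
    ≈⟨ ∑²-·ˡ N (q^ 1) _ ⟨
  q^ 1 · ∑² N (λ s t → dilate 4 (latticeTerm R s t))
    ≈⟨ ·-congˡ (≈-trans (dilate-∑ 4 N _) (∑-cong N λ s _ → dilate-∑ 4 N _)) ⟨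
  q^ 1 · dilate 4 (∑² N (latticeTerm R))
    ≈⟨ ·-congˡ (dilate-cong 4 (lattice-sum N R)) ⟩
  q^ 1 · dilate 4 (evaluate-moments N R) ∎
  where
  open Solver N
  open ≈-Reasoning N
  graph : ℕ → ℕ → ℕ → ℕ → PowerSeries
  graph k l s t = indicator (rot₁ s t ℕ.≟ k) · indicator (rot₂ s t ℕ.≟ l) · latticeTerm P k l

  graph-off : ∀ k l s t → ¬ (k ≡ rot₁ s t × l ≡ rot₂ s t) → graph k l s t ≈[ N ] # 0
  graph-off k l s t ne with rot₁ s t ℕ.≟ k | rot₂ s t ℕ.≟ l
  ... | yes p | yes r = ⊥-elim (ne (≡.sym p , ≡.sym r))
  ... | yes p | no _  = solve 1 (λ f → con 1 :* con 0 :* f := con 0) ≈-refl (latticeTerm P k l)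
  ... | no _  | yes _ = solve 1 (λ f → con 0 :* con 1 :* f := con 0) ≈-refl (latticeTerm P k l)
  ... | no _  | no _  = solve 1 (λ f → con 0 :* con 0 :* f := con 0) ≈-refl (latticeTerm P k l)

  graph-on : ∀ k l s t → rot₁ s t ≡ k → rot₂ s t ≡ l → graph k l s t ≈[ N ] latticeTerm P k l
  graph-on k l s t p r with rot₁ s t ℕ.≟ k | rot₂ s t ℕ.≟ l
  ... | yes _ | yes _ = solve 1 (λ f → con 1 :* con 1 :* f := f) ≈-refl (latticeTerm P k l)
  ... | yes _ | no ¬r = ⊥-elim (¬r r)
  ... | no ¬p | _     = ⊥-elim (¬p p)

  graph-zero : ∀ k l → latticeTerm P k l ≈[ N ] # 0 → ∀ s t → graph k l s t ≈[ N ] # 0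
  graph-zero k l p s t = ≈-trans (·-congˡ p) (·-zeroʳ _)

  insert : ∀ k l → latticeTerm P k l ≈[ N ] ∑² N (graph k l)
  -- A term vanishes if its norm exceeds the precision or if (k , l) lies off the image lattice;
  -- otherwise exactly one (s , t) maps to it.
  insert k l with norm k l <? N | + 5 ∣? (signedOdd l ℤ.- + 2 ℤ.* signedOdd k)
  ... | no ≮N | _ = ≈-trans zero′ (≈-sym (∑²-zero N λ s t _ _ → graph-zero k l zero′ s t))
    where
    zero′ : latticeTerm P k l ≈[ N ] # 0
    zero′ = latticeTerm≈0 P k l (ℕ.≮⇒≥ ≮N)
  ... | yes _ | no ∤ = ≈-trans zero′ (≈-sym (∑²-zero N λ s t _ _ → graph-zero k l zero′ s t))
    where
    zero′ : latticeTerm P k l ≈[ N ] # 0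
    zero′ = ≈-trans (·-congʳ (const-cong (off (signedOdd k) (signedOdd l) ∤))) (·-zeroˡ _)
  ... | yes <N | yes div with s , t , p , r ← rot-surjective k l div =
    ≈-sym (≈-trans (∑²-single N s t s<N t<N unique) (graph-on k l s t p r))
    where
    -- As `norm k l` is 5 `norm s t` + 1, the preimage lies inside the summation range.
    norm-st<N : norm s t < N
    norm-st<N = ℕ.≤-<-trans (ℕ.≤-trans (ℕ.m≤m*n (norm s t) 5) (ℕ.≤-trans (ℕ.n≤1+n _)
      (ℕ.≤-reflexive (≡.trans (≡.sym (rot-△ s t)) (cong₂ norm p r))))) <N
    s<N : s < N
    s<N = ℕ.≤-<-trans (m≤norm s t) norm-st<N
    t<N : t < N
    t<N = ℕ.≤-<-trans (n≤norm s t) norm-st<N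
    unique : ∀ s′ t′ → ¬ (s′ ≡ s × t′ ≡ t) → graph k l s′ t′ ≈[ N ] # 0
    unique s′ t′ ne = graph-off k l s′ t′ λ (k≡ , l≡) → ne
      (rot-injective {s′} {t′} {s} {t} (≡.trans (≡.sym k≡) (≡.sym p)) (≡.trans (≡.sym l≡) (≡.sym r)))

  evaluate-graph : ∀ s t → ∑² N (λ k l → graph k l s t) ≈[ N ] q^ 1 · dilate 4 (latticeTerm R s t)
  evaluate-graph s t = ≈-trans (collapse (norm k l <? N)) image
    where
    k = rot₁ s t
    l = rot₂ s t
    collapse : Dec (norm k l < N) → ∑² N (λ k l → graph k l s t) ≈[ N ] latticeTerm P k l
    collapse (yes <N) = ≈-trans
      (∑²-single N k l (ℕ.≤-<-trans (m≤norm k l) <N)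
        (ℕ.≤-<-trans (n≤norm k l) <N) λ k′ l′ → graph-off k′ l′ s t)
      (graph-on k l s t refl refl)
    collapse (no ≮N) = ≈-trans (∑²-zero N vanish) (≈-sym zero′)
      where
      zero′ : latticeTerm P k l ≈[ N ] # 0
      zero′ = latticeTerm≈0 P k l (ℕ.≮⇒≥ ≮N)
      vanish : ∀ k′ l′ → k′ < N → l′ < N → graph k′ l′ s t ≈[ N ] # 0
      vanish k′ l′ _ _ with k′ ℕ.≟ k | l′ ℕ.≟ l
      ... | yes refl | yes refl = graph-zero k l zero′ s t
      ... | no k′≢k  | _        = graph-off k′ l′ s t (k′≢k ∘ proj₁)
      ... | yes _    | no l′≢l  = graph-off k′ l′ s t (l′≢l ∘ proj₂)
    r = evaluate R (signedOdd s) (signedOdd t)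
    image : latticeTerm P k l ≈[ N ] q^ 1 · dilate 4 (latticeTerm R s t)
    image = begin
      latticeTerm P k l
        ≈⟨ ·-cong (const-cong (∼-trans (∼-reflexive (cong₂ (evaluate P) (proj₂ (rotate₁ s t)) (proj₂ (rotate₂ s t)))) (on (signedOdd s) (signedOdd t))))
             (SeriesEq.reflexive (cong q^_ (rot-△ s t))) ⟩
      const r · q^ (1 + norm s t * 5)
        ≈⟨ ·-congˡ (q^-+ 1 (norm s t * 5)) ⟩
      const r · (q^ 1 · q^ (norm s t * 5))
        ≈⟨ solve 3 (λ r a b → r :* (a :* b) := a :* (r :* b)) ≈-refl (const r) (q^ 1) (q^ (norm s t * 5)) ⟩
      q^ 1 · (const r · q^ (norm s t * 5))
        ≈⟨ ·-congˡ (≈-trans (dilate-const-· 4 r _) (·-congˡ (dilate-q^ 4 (norm s t)))) ⟨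
      q^ 1 · dilate 4 (latticeTerm R s t) ∎

-- The polynomial (1 - (z - 2x)^4) x^a z^b modulo 5, whose first factor is the indicator of z ≡ 2x.
kernel : ℕ → ℕ → Polynomial₂
kernel a b =
  (1 , a , b) ∷ (4 , a , 4 + b) ∷ (3 , 1 + a , 3 + b) ∷ (1 , 2 + a , 2 + b) ∷ (2 , 3 + a , 1 + b) ∷ (4 , 4 + a , b) ∷ []

prime-5 : Prime 5
prime-5 = from-yes (prime? 5)

indicator₅ : ℤ → ℤ
indicator₅ y = 1ℤ ℤ.- y ℤ.* y ℤ.* y ℤ.* y

-- By Fermat 5 divides y (1 - y⁴), and 5 is prime.
indicator₅-unit : ∀ y → ¬ (+ 5 ∣.∣ y) → indicator₅ y ∼ 0ℤ
indicator₅-unit y 5∤y = mod5 (subst (+ 5 ∣.∣_) (≡.sym (ℤ.+-identityʳ (indicator₅ y))) (∣.∣ᵤ⇒∣ {+ 5} {indicator₅ y} cofactor))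
  where
  lem : ∀ y → y ℤ.- y ℤ.* (y ℤ.* (y ℤ.* (y ℤ.* (y ℤ.* 1ℤ)))) ≡ y ℤ.* (1ℤ ℤ.- y ℤ.* y ℤ.* y ℤ.* y)
  lem = solve-∀
  vanishing : + 5 ∣.∣ (y ℤ.* indicator₅ y)
  vanishing = subst (+ 5 ∣.∣_) (lem y) (_∼_.difference (∼-sym (fermat y)))
  cofactor : 5 ∣ ℤ.∣ indicator₅ y ∣
  cofactor = Sum.fromInj₂ (λ 5∣y → ⊥-elim (5∤y (∣.∣ᵤ⇒∣ {+ 5} {y} 5∣y))) (euclidsLemma ℤ.∣ y ∣ ℤ.∣ indicator₅ y ∣ prime-5
    (subst (5 ∣_) (ℤ.abs-* y (indicator₅ y)) (∣.∣⇒∣ᵤ vanishing)))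

evaluate-kernel : ∀ a b x z → evaluate (kernel a b) x z ∼ indicator₅ (z ℤ.- + 2 ℤ.* x) ℤ.* (x ℤ.^ a ℤ.* z ℤ.^ b)
evaluate-kernel a b x z = by-quotient
  ((z ℤ.* z ℤ.* z ℤ.* z ℤ.- x ℤ.* z ℤ.* z ℤ.* z ℤ.+ + 5 ℤ.* (x ℤ.* x ℤ.* z ℤ.* z) ℤ.- + 6 ℤ.* (x ℤ.* x ℤ.* x ℤ.* z) ℤ.+ + 4 ℤ.* (x ℤ.* x ℤ.* x ℤ.* x))
    ℤ.* (x ℤ.^ a ℤ.* z ℤ.^ b))
  (lem x z (x ℤ.^ a) (z ℤ.^ b))
  where
  lem : ∀ x z A B →
    + 1 ℤ.* (A ℤ.* B) ℤ.+ (+ 4 ℤ.* (A ℤ.* (z ℤ.* (z ℤ.* (z ℤ.* (z ℤ.* B))))) ℤ.+ (+ 3 ℤ.* (x ℤ.* A ℤ.* (z ℤ.* (z ℤ.* (z ℤ.* B))))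
      ℤ.+ (+ 1 ℤ.* (x ℤ.* (x ℤ.* A) ℤ.* (z ℤ.* (z ℤ.* B))) ℤ.+ (+ 2 ℤ.* (x ℤ.* (x ℤ.* (x ℤ.* A)) ℤ.* (z ℤ.* B))
      ℤ.+ (+ 4 ℤ.* (x ℤ.* (x ℤ.* (x ℤ.* (x ℤ.* A))) ℤ.* B) ℤ.+ 0ℤ)))))
    ≡ (1ℤ ℤ.- (z ℤ.- + 2 ℤ.* x) ℤ.* (z ℤ.- + 2 ℤ.* x) ℤ.* (z ℤ.- + 2 ℤ.* x) ℤ.* (z ℤ.- + 2 ℤ.* x)) ℤ.* (A ℤ.* B)
      ℤ.+ (z ℤ.* z ℤ.* z ℤ.* z ℤ.- x ℤ.* z ℤ.* z ℤ.* z ℤ.+ + 5 ℤ.* (x ℤ.* x ℤ.* z ℤ.* z) ℤ.- + 6 ℤ.* (x ℤ.* x ℤ.* x ℤ.* z) ℤ.+ + 4 ℤ.* (x ℤ.* x ℤ.* x ℤ.* x))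
        ℤ.* (A ℤ.* B) ℤ.* + 5
  lem = solve-∀

kernel-off : ∀ a b x z → ¬ (+ 5 ∣.∣ (z ℤ.- + 2 ℤ.* x)) → evaluate (kernel a b) x z ∼ 0ℤ
kernel-off a b x z 5∤ = ∼-trans (evaluate-kernel a b x z) (∼-* (indicator₅-unit _ 5∤) (∼-refl {x ℤ.^ a ℤ.* z ℤ.^ b}))

kernel-on : ∀ a b s t → let x = + 2 ℤ.* t ℤ.- s ; z = ℤ.- (+ 2 ℤ.* s) ℤ.- t in
  evaluate (kernel a b) x z ∼ x ℤ.^ a ℤ.* z ℤ.^ b
kernel-on a b s t = ∼-trans (evaluate-kernel a b x z) (∼-trans (∼-* one∼ (∼-refl {w})) (∼-reflexive (ℤ.*-identityˡ w)))
  where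
  x = + 2 ℤ.* t ℤ.- s
  z = ℤ.- (+ 2 ℤ.* s) ℤ.- t
  w = x ℤ.^ a ℤ.* z ℤ.^ b
  lem : ∀ s t → let y = (ℤ.- (+ 2 ℤ.* s) ℤ.- t) ℤ.- + 2 ℤ.* (+ 2 ℤ.* t ℤ.- s) in
    1ℤ ℤ.- y ℤ.* y ℤ.* y ℤ.* y ≡ 1ℤ ℤ.+ (ℤ.- + 125 ℤ.* (t ℤ.* t ℤ.* t ℤ.* t)) ℤ.* + 5
  lem = solve-∀
  one∼ : indicator₅ (z ℤ.- + 2 ℤ.* x) ∼ 1ℤ
  -- On the image z - 2x = -5t, so the indicator is 1 - 625 t⁴.
  one∼ = by-quotient (ℤ.- + 125 ℤ.* (t ℤ.* t ℤ.* t ℤ.* t)) (lem s t)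

moment-cong : ∀ {N} n i j → (∀ x → x ℤ.^ i ∼ x ℤ.^ j) → moment n i ≈[ N ] moment n j
moment-cong n i j p = ∑-cong n λ k _ → ·-congʳ (const-cong (p (signedOdd k)))

moment₅ : ∀ {N} n → moment n 5 ≈[ N ] moment n 1
moment₅ n = moment-cong n 5 1 λ x → ∼-trans (fermat x) (∼-reflexive (≡.sym (ℤ.*-identityʳ x)))

-- Only positive powers are periodic: `moment n 0` and `moment n 4` differ by the terms with 5 | x.
moment₆ : ∀ {N} n → moment n 6 ≈[ N ] moment n 2
moment₆ n = moment-cong n 6 2 λ x → ∼-* (∼-refl {x}) (∼-trans (fermat x) (∼-reflexive (≡.sym (ℤ.*-identityʳ x))))

-- The three rotation identities

module _ (N : ℕ) where
  private
    open Solver N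
    open ≈-Reasoning N
    m₀ = moment N 0
    m₁ = moment N 1
    m₂ = moment N 2
    m₃ = moment N 3
    m₄ = moment N 4

  rotation-1 : m₀ · m₀ ⊖ # 2 · (m₀ · m₄) ⊕ m₂ · m₂ ≈[ N ] q^ 1 · dilate 4 (m₀ · m₀)
  rotation-1 = begin
    m₀ · m₀ ⊖ # 2 · (m₀ · m₄) ⊕ m₂ · m₂
      ≈⟨ solve 5 (λ a b c d e → a :* a :- con 2 :* (a :* e) :+ c :* c
           := con 1 :* (a :* a) :+ (con 4 :* (a :* e) :+ (con 3 :* (b :* d) :+ (con 1 :* (c :* c) :+ (con 2 :* (d :* b) :+ (con 4 :* (e :* a) :+ con 0))))))
           ≈-refl m₀ m₁ m₂ m₃ m₄ ⟩
    evaluate-moments N (kernel 0 0)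
      ≈⟨ lattice-rotation N (kernel 0 0) ((1 , 0 , 0) ∷ []) (kernel-off 0 0) (kernel-on 0 0) ⟩
    q^ 1 · dilate 4 (# 1 · (m₀ · m₀) ⊕ # 0)
      ≈⟨ ·-congˡ (dilate-cong 4 (solve 1 (λ a → con 1 :* (a :* a) :+ con 0 := a :* a) ≈-refl m₀)) ⟩
    q^ 1 · dilate 4 (m₀ · m₀) ∎

  -- The sum of x over z ≡ 2x. On the image x = 2t - s, and 2 m₀ m₁ - m₁ m₀ = m₀ m₁.
  rotation-x : m₁ · m₄ ⊖ m₂ · m₃ ≈[ N ] q^ 1 · dilate 4 (m₀ · m₁)
  rotation-x = begin
    m₁ · m₄ ⊖ m₂ · m₃
      ≈⟨ solve 5 (λ a b c d e → b :* e :- c :* d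
           := con 1 :* (b :* a) :+ (con 4 :* (b :* e) :+ (con 3 :* (c :* d) :+ (con 1 :* (d :* c) :+ (con 2 :* (e :* b) :+ (con 4 :* (b :* a) :+ con 0))))))
           ≈-refl m₀ m₁ m₂ m₃ m₄ ⟩
    _ ≈⟨ ⊕-cong ≈-refl (⊕-cong ≈-refl (⊕-cong ≈-refl (⊕-cong ≈-refl (⊕-cong ≈-refl (⊕-cong (·-congˡ (·-congʳ (moment₅ N))) ≈-refl))))) ⟨
    evaluate-moments N (kernel 1 0)
      ≈⟨ lattice-rotation N (kernel 1 0) ((2 , 0 , 1) ∷ (4 , 1 , 0) ∷ []) (kernel-off 1 0) on ⟩
    q^ 1 · dilate 4 (# 2 · (m₀ · m₁) ⊕ (# 4 · (m₁ · m₀) ⊕ # 0))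
      ≈⟨ ·-congˡ (dilate-cong 4 (solve 2 (λ a b → con 2 :* (a :* b) :+ (con 4 :* (b :* a) :+ con 0) := a :* b) ≈-refl m₀ m₁)) ⟩
    q^ 1 · dilate 4 (m₀ · m₁) ∎
    where
    lem : ∀ s t → (+ 2 ℤ.* t ℤ.- s) ℤ.* 1ℤ ℤ.* 1ℤ
      ≡ + 2 ℤ.* (1ℤ ℤ.* (t ℤ.* 1ℤ)) ℤ.+ (+ 4 ℤ.* (s ℤ.* 1ℤ ℤ.* 1ℤ) ℤ.+ 0ℤ) ℤ.+ (ℤ.- s) ℤ.* + 5
    lem = solve-∀
    on : ∀ s t → evaluate (kernel 1 0) (+ 2 ℤ.* t ℤ.- s) (ℤ.- (+ 2 ℤ.* s) ℤ.- t) ∼ evaluate ((2 , 0 , 1) ∷ (4 , 1 , 0) ∷ []) s t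
    on s t = ∼-trans (kernel-on 1 0 s t) (by-quotient (ℤ.- s) (lem s t))

  -- The sum of xz over z ≡ 2x. On the image xz ≡ 2st + 2s² + 3t² modulo 5, and the two square terms
  -- cancel by the symmetry of s and t.
  rotation-xz : m₃ · m₃ ⊖ m₁ · m₁ ≈[ N ] q^ 1 · dilate 4 (# 2 · (m₁ · m₁))
  rotation-xz = begin
    m₃ · m₃ ⊖ m₁ · m₁
      ≈⟨ solve 5 (λ a b c d e → d :* d :- b :* b
           := con 1 :* (b :* b) :+ (con 4 :* (b :* b) :+ (con 3 :* (c :* e) :+ (con 1 :* (d :* d) :+ (con 2 :* (e :* c) :+ (con 4 :* (b :* b) :+ con 0))))))
           ≈-refl m₀ m₁ m₂ m₃ m₄ ⟩
    _ ≈⟨ ⊕-cong ≈-refl (⊕-cong (·-congˡ (·-congˡ (moment₅ N)))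
           (⊕-cong ≈-refl (⊕-cong ≈-refl (⊕-cong ≈-refl (⊕-cong (·-congˡ (·-congʳ (moment₅ N))) ≈-refl))))) ⟨
    evaluate-moments N (kernel 1 1)
      ≈⟨ lattice-rotation N (kernel 1 1) ((2 , 1 , 1) ∷ (2 , 2 , 0) ∷ (3 , 0 , 2) ∷ []) (kernel-off 1 1) on ⟩
    q^ 1 · dilate 4 (# 2 · (m₁ · m₁) ⊕ (# 2 · (m₂ · m₀) ⊕ (# 3 · (m₀ · m₂) ⊕ # 0)))
      ≈⟨ ·-congˡ (dilate-cong 4 (solve 3 (λ a b c → con 2 :* (b :* b) :+ (con 2 :* (c :* a) :+ (con 3 :* (a :* c) :+ con 0)) := con 2 :* (b :* b)) ≈-refl m₀ m₁ m₂)) ⟩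
    q^ 1 · dilate 4 (# 2 · (m₁ · m₁)) ∎
    where
    lem : ∀ s t → (+ 2 ℤ.* t ℤ.- s) ℤ.* 1ℤ ℤ.* ((ℤ.- (+ 2 ℤ.* s) ℤ.- t) ℤ.* 1ℤ)
      ≡ + 2 ℤ.* (s ℤ.* 1ℤ ℤ.* (t ℤ.* 1ℤ)) ℤ.+ (+ 2 ℤ.* (s ℤ.* (s ℤ.* 1ℤ) ℤ.* 1ℤ) ℤ.+ (+ 3 ℤ.* (1ℤ ℤ.* (t ℤ.* (t ℤ.* 1ℤ))) ℤ.+ 0ℤ))
        ℤ.+ (ℤ.- (s ℤ.* t) ℤ.- t ℤ.* t) ℤ.* + 5
    lem = solve-∀
    on : ∀ s t → evaluate (kernel 1 1) (+ 2 ℤ.* t ℤ.- s) (ℤ.- (+ 2 ℤ.* s) ℤ.- t) ∼ evaluate ((2 , 1 , 1) ∷ (2 , 2 , 0) ∷ (3 , 0 , 2) ∷ []) s t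
    on s t = ∼-trans (kernel-on 1 1 s t) (by-quotient (ℤ.- (s ℤ.* t) ℤ.- t ℤ.* t) (lem s t))

-- Dissection by exponents modulo 5

ϑ-∑ : ∀ {N} n f → ϑ (∑ n f) ≈[ N ] ∑[ k < n ] ϑ (f k)
ϑ-∑ {N} zero f = ≈-trans (ϑ-cong (≈-sym (·-zeroˡ (# 0)))) (≈-trans (ϑ-const-· 0ℤ (# 0)) (·-zeroˡ _))
ϑ-∑ (suc n) f = ≈-trans (ϑ-⊕ _ _) (⊕-cong (ϑ-∑ n f) ≈-refl)

-- Since 8 △ = x² - 1 and 2 is the inverse of 8 modulo 5.
△-∼ : ∀ k → + △ (suc k) ∼ + 2 ℤ.* (signedOdd k ℤ.* signedOdd k) ℤ.- + 2
△-∼ k = by-quotient (ℤ.- (+ 3 ℤ.* + △ (suc k)))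
  (≡.trans (lem (+ △ (suc k))) (cong (λ z → + 2 ℤ.* z ℤ.- + 2 ℤ.+ (ℤ.- (+ 3 ℤ.* + △ (suc k))) ℤ.* + 5) (≡.sym (signedOdd² k))))
  where
  lem : ∀ t → t ≡ + 2 ℤ.* (+ 8 ℤ.* t ℤ.+ 1ℤ) ℤ.- + 2 ℤ.+ (ℤ.- (+ 3 ℤ.* t)) ℤ.* + 5
  lem = solve-∀

-- The exponent of the term of x is ≡ 2x² - 2, so q d/dq acts linearly on the moments and its
-- eigenvectors can be written down.
ϑ-moment : ∀ {N} n i → ϑ (moment n i) ≈[ N ] # 2 · moment n (2 + i) ⊖ # 2 · moment n i
ϑ-moment {N} n i = begin
  ϑ (moment n i)
    ≈⟨ ≈-trans (ϑ-∑ n _) (∑-cong n λ k _ → term k) ⟩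
  ∑[ k < n ] (# 2 · m (2 + i) k ⊕ # 3 · m i k)
    ≈⟨ ≈-trans (∑-⊕ n _ _) (⊕-cong (≈-sym (∑-·ˡ n _ _)) (≈-sym (∑-·ˡ n _ _))) ⟩
  # 2 · moment n (2 + i) ⊕ # 3 · moment n i
    ≈⟨ solve 2 (λ a b → con 2 :* a :+ con 3 :* b := con 2 :* a :- con 2 :* b) ≈-refl (moment n (2 + i)) (moment n i) ⟩
  # 2 · moment n (2 + i) ⊖ # 2 · moment n i ∎
  where
  open Solver N
  open ≈-Reasoning N
  m : ℕ → ℕ → PowerSeries
  m i k = const (signedOdd k ℤ.^ i) · q^ △ (suc k)
  coefficient : ∀ k → signedOdd k ℤ.^ i ℤ.* + △ (suc k) ∼ + 2 ℤ.* signedOdd k ℤ.^ (2 + i) ℤ.+ + 3 ℤ.* signedOdd k ℤ.^ i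
  coefficient k = ∼-trans (∼-* (∼-refl {signedOdd k ℤ.^ i}) (△-∼ k)) (by-quotient (ℤ.- (signedOdd k ℤ.^ i)) (lem (signedOdd k) (signedOdd k ℤ.^ i)))
    where
    lem : ∀ x A → A ℤ.* (+ 2 ℤ.* (x ℤ.* x) ℤ.- + 2) ≡ + 2 ℤ.* (x ℤ.* (x ℤ.* A)) ℤ.+ + 3 ℤ.* A ℤ.+ ℤ.- A ℤ.* + 5
    lem = solve-∀
  term : ∀ k → ϑ (m i k) ≈[ N ] # 2 · m (2 + i) k ⊕ # 3 · m i k
  term k = begin
    ϑ (m i k)
      ≈⟨ ≈-trans (ϑ-const-· _ _) (·-congˡ (ϑ-q^ (△ (suc k)))) ⟩
    const (signedOdd k ℤ.^ i) · (const (+ △ (suc k)) · q^ △ (suc k))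
      ≈⟨ ≈-trans (≈-sym (·-assoc _ _ _)) (·-congʳ (≈-trans (≈-sym (const-· _ _)) (const-cong (coefficient k)))) ⟩
    const (+ 2 ℤ.* signedOdd k ℤ.^ (2 + i) ℤ.+ + 3 ℤ.* signedOdd k ℤ.^ i) · q^ △ (suc k)
      ≈⟨ ·-congʳ (≈-trans (const-+ _ _) (⊕-cong (const-· _ _) (const-· _ _))) ⟩
    (# 2 · const (signedOdd k ℤ.^ (2 + i)) ⊕ # 3 · const (signedOdd k ℤ.^ i)) · q^ △ (suc k)
      ≈⟨ solve 3 (λ a b q → (con 2 :* a :+ con 3 :* b) :* q := con 2 :* (a :* q) :+ con 3 :* (b :* q)) ≈-refl
           (const (signedOdd k ℤ.^ (2 + i))) (const (signedOdd k ℤ.^ i)) (q^ △ (suc k)) ⟩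
    # 2 · m (2 + i) k ⊕ # 3 · m i k ∎

-- f is supported modulo q^N on the exponents n ≡ c.
Supported : ℕ → ℕ → PowerSeries → Set
Supported N c f = ϑ f ≈[ N ] # c · f

supported-· : ∀ {N c d f g} → Supported N c f → Supported N d g → Supported N (c + d) (f · g)
supported-· {N} {c} {d} {f} {g} p r = begin
  ϑ (f · g)                       ≈⟨ leibniz f g ⟩
  ϑ f · g ⊕ f · ϑ g               ≈⟨ ⊕-cong (·-congʳ p) (·-congˡ r) ⟩
  # c · f · g ⊕ f · (# d · g)     ≈⟨ solve 4 (λ c d f g → c :* f :* g :+ f :* (d :* g) := (c :+ d) :* (f :* g)) ≈-refl (# c) (# d) f g ⟩
  (# c ⊕ # d) · (f · g)           ≈⟨ ·-congʳ (const-+ (+ c) (+ d)) ⟨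
  # (c + d) · (f · g)             ∎
  where
  open Solver N
  open ≈-Reasoning N

ϑ-dilate : ∀ {N} k f → ϑ (dilate k f) ≈[ N ] # suc k · dilate k (ϑ f)
ϑ-dilate {zero}  k f = ≈-zero
ϑ-dilate {suc N} k f = begin
  ϑ (dilate k f)
    ≈⟨ ≈-trans (ϑ-cong (dilate-head+tail k f)) (≈-trans (ϑ-⊕ _ _) (⊕-cong (ϑ-const (f 0)) (leibniz X (dilate k f′)))) ⟩
  # 0 ⊕ (ϑ X · dilate k f′ ⊕ X · ϑ (dilate k f′))
    ≈⟨ ⊕-cong ≈-refl (⊕-cong (·-congʳ (ϑ-q^ (suc k))) (raise k (ϑ-dilate k f′))) ⟩
  # 0 ⊕ (# suc k · X · dilate k f′ ⊕ X · (# suc k · dilate k (ϑ f′)))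
    ≈⟨ solve 4 (λ c X f g → con 0 :+ (c :* X :* f :+ X :* (c :* g)) := c :* (X :* (f :+ g))) ≈-refl (# suc k) X (dilate k f′) (dilate k (ϑ f′)) ⟩
  # suc k · (X · (dilate k f′ ⊕ dilate k (ϑ f′)))
    ≈⟨ ·-congˡ (·-cong (≈-trans (dilate-q^ k 1) (SeriesEq.reflexive (cong q^_ (ℕ.*-identityˡ (suc k))))) (dilate-⊕ k f′ (ϑ f′))) ⟨
  # suc k · (dilate k (q^ 1) · dilate k (f′ ⊕ ϑ f′))
    ≈⟨ ·-congˡ (≈-trans (dilate-cong k (ϑ-tail f)) (dilate-· k (q^ 1) (f′ ⊕ ϑ f′))) ⟨
  # suc k · dilate k (ϑ f) ∎
  where
  X = q^ suc k
  f′ = tail f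
  open Solver (suc N)
  open ≈-Reasoning (suc N)

supported-dilate : ∀ {N c f} → Supported N c f → Supported N (2 * c) (dilate 1 f)
supported-dilate {N} {c} {f} p = begin
  ϑ (dilate 1 f)            ≈⟨ ≈-trans (ϑ-dilate 1 f) (·-congˡ (≈-trans (dilate-cong 1 p) (dilate-const-· 1 (+ c) f))) ⟩
  # 2 · (# c · dilate 1 f)  ≈⟨ ≈-trans (·-congʳ (≈-trans (const-cong (∼-reflexive (ℤ.pos-* 2 c))) (const-· (+ 2) (+ c)))) (·-assoc _ _ _) ⟨
  # (2 * c) · dilate 1 f    ∎
  where open ≈-Reasoning N

opaque
  unfolding q^_

  section-q^·const : ∀ {N} r c → section r (q^ r · const c) ≈[ N ] const c
  section-q^·const r c = pointwise λ n → ≡.trans (cong (q^ r · const c) (ℕ.+-comm (n * 5) r)) (≡.trans (q^-·-+ r (const c) (n * 5)) (lem n))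
    where
    lem : ∀ n → const c (n * 5) ≡ const c n
    lem zero    = refl
    lem (suc _) = refl

  0-coeff : ∀ n → const 0ℤ n ≡ 0ℤ
  0-coeff zero    = refl
  0-coeff (suc _) = refl

-- The Hecke relation for J² ψ²

module _ (N : ℕ) where
  private
    open Solver N
    open ≈-Reasoning N
    m₀ = moment N 0
    m₁ = moment N 1
    m₂ = moment N 2
    m₃ = moment N 3
    m₄ = moment N 4
    -- The exponent 2x² - 2 is ≡ 0, 1 or 3 according as x² ≡ 1, x² ≡ -1 or x ≡ 0. As 3 is 1/2 modulo
    -- 5, the indicators of these cases are 3(x⁴ + x²), 3(x⁴ - x²) and 1 - x⁴, giving `P₀`, `P₁`,
    -- `P₃`. In `J₀` and `J₁` the weight x removes the third case.
    J₀ = # 3 · (m₁ ⊕ m₃)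
    J₁ = # 3 · (m₁ ⊖ m₃)
    P₀ = # 3 · (m₄ ⊕ m₂)
    P₁ = # 3 · (m₄ ⊖ m₂)
    P₃ = m₀ ⊖ m₄

    ϑ-combination : ∀ a i b j → ϑ (# a · moment N i ⊕ # b · moment N j) ≈[ N ]
      # a · (# 2 · moment N (2 + i) ⊖ # 2 · moment N i) ⊕ # b · (# 2 · moment N (2 + j) ⊖ # 2 · moment N j)
    ϑ-combination a i b j = ≈-trans (ϑ-⊕ _ _) (⊕-cong (≈-trans (ϑ-const-· _ _) (·-congˡ (ϑ-moment N i))) (≈-trans (ϑ-const-· _ _) (·-congˡ (ϑ-moment N j))))

    J₀-supported : Supported N 0 J₀
    J₀-supported = begin
      ϑ J₀
        ≈⟨ ≈-trans (ϑ-cong (solve 2 (λ a b → con 3 :* (a :+ b) := con 3 :* a :+ con 3 :* b) ≈-refl m₁ m₃)) (ϑ-combination 3 1 3 3) ⟩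
      # 3 · (# 2 · m₃ ⊖ # 2 · m₁) ⊕ # 3 · (# 2 · moment N 5 ⊖ # 2 · m₃)
        ≈⟨ ⊕-cong ≈-refl (·-congˡ (⊕-cong (·-congˡ (moment₅ N)) ≈-refl)) ⟩
      # 3 · (# 2 · m₃ ⊖ # 2 · m₁) ⊕ # 3 · (# 2 · m₁ ⊖ # 2 · m₃)
        ≈⟨ solve 2 (λ a b → con 3 :* (con 2 :* b :- con 2 :* a) :+ con 3 :* (con 2 :* a :- con 2 :* b) := con 0 :* (con 3 :* (a :+ b))) ≈-refl m₁ m₃ ⟩
      # 0 · J₀ ∎

    J₁-supported : Supported N 1 J₁
    J₁-supported = begin
      ϑ J₁
        ≈⟨ ≈-trans (ϑ-cong (solve 2 (λ a b → con 3 :* (a :- b) := con 3 :* a :+ con 2 :* b) ≈-refl m₁ m₃)) (ϑ-combination 3 1 2 3) ⟩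
      # 3 · (# 2 · m₃ ⊖ # 2 · m₁) ⊕ # 2 · (# 2 · moment N 5 ⊖ # 2 · m₃)
        ≈⟨ ⊕-cong ≈-refl (·-congˡ (⊕-cong (·-congˡ (moment₅ N)) ≈-refl)) ⟩
      # 3 · (# 2 · m₃ ⊖ # 2 · m₁) ⊕ # 2 · (# 2 · m₁ ⊖ # 2 · m₃)
        ≈⟨ solve 2 (λ a b → con 3 :* (con 2 :* b :- con 2 :* a) :+ con 2 :* (con 2 :* a :- con 2 :* b) := con 1 :* (con 3 :* (a :- b))) ≈-refl m₁ m₃ ⟩
      # 1 · J₁ ∎

    P₀-supported : Supported N 0 P₀
    P₀-supported = begin
      ϑ P₀
        ≈⟨ ≈-trans (ϑ-cong (solve 2 (λ a b → con 3 :* (b :+ a) := con 3 :* a :+ con 3 :* b) ≈-refl m₂ m₄)) (ϑ-combination 3 2 3 4) ⟩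
      # 3 · (# 2 · m₄ ⊖ # 2 · m₂) ⊕ # 3 · (# 2 · moment N 6 ⊖ # 2 · m₄)
        ≈⟨ ⊕-cong ≈-refl (·-congˡ (⊕-cong (·-congˡ (moment₆ N)) ≈-refl)) ⟩
      # 3 · (# 2 · m₄ ⊖ # 2 · m₂) ⊕ # 3 · (# 2 · m₂ ⊖ # 2 · m₄)
        ≈⟨ solve 2 (λ a b → con 3 :* (con 2 :* b :- con 2 :* a) :+ con 3 :* (con 2 :* a :- con 2 :* b) := con 0 :* (con 3 :* (b :+ a))) ≈-refl m₂ m₄ ⟩
      # 0 · P₀ ∎

    P₁-supported : Supported N 1 P₁
    P₁-supported = begin
      ϑ P₁
        ≈⟨ ≈-trans (ϑ-cong (solve 2 (λ a b → con 3 :* (b :- a) := con 2 :* a :+ con 3 :* b) ≈-refl m₂ m₄)) (ϑ-combination 2 2 3 4) ⟩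
      # 2 · (# 2 · m₄ ⊖ # 2 · m₂) ⊕ # 3 · (# 2 · moment N 6 ⊖ # 2 · m₄)
        ≈⟨ ⊕-cong ≈-refl (·-congˡ (⊕-cong (·-congˡ (moment₆ N)) ≈-refl)) ⟩
      # 2 · (# 2 · m₄ ⊖ # 2 · m₂) ⊕ # 3 · (# 2 · m₂ ⊖ # 2 · m₄)
        ≈⟨ solve 2 (λ a b → con 2 :* (con 2 :* b :- con 2 :* a) :+ con 3 :* (con 2 :* a :- con 2 :* b) := con 1 :* (con 3 :* (b :- a))) ≈-refl m₂ m₄ ⟩
      # 1 · P₁ ∎

    P₃-supported : Supported N 3 P₃
    P₃-supported = begin
      ϑ P₃
        ≈⟨ ≈-trans (ϑ-cong (solve 2 (λ a b → a :- b := con 1 :* a :+ con 4 :* b) ≈-refl m₀ m₄)) (ϑ-combination 1 0 4 4) ⟩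
      # 1 · (# 2 · m₂ ⊖ # 2 · m₀) ⊕ # 4 · (# 2 · moment N 6 ⊖ # 2 · m₄)
        ≈⟨ ⊕-cong ≈-refl (·-congˡ (⊕-cong (·-congˡ (moment₆ N)) ≈-refl)) ⟩
      # 1 · (# 2 · m₂ ⊖ # 2 · m₀) ⊕ # 4 · (# 2 · m₂ ⊖ # 2 · m₄)
        ≈⟨ solve 3 (λ a b c → con 1 :* (con 2 :* b :- con 2 :* a) :+ con 4 :* (con 2 :* b :- con 2 :* c) := con 3 :* (a :- c)) ≈-refl m₀ m₂ m₄ ⟩
      # 3 · P₃ ∎

    m₁≈J : m₁ ≈[ N ] J₀ ⊕ J₁
    m₁≈J = solve 2 (λ a b → a := con 3 :* (a :+ b) :+ con 3 :* (a :- b)) ≈-refl m₁ m₃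

    m₀≈P : m₀ ≈[ N ] P₀ ⊕ P₁ ⊕ P₃
    m₀≈P = solve 3 (λ a b c → a := con 3 :* (c :+ b) :+ con 3 :* (c :- b) :+ (a :- c)) ≈-refl m₀ m₂ m₄

  -- The part of m₁² m₀² = (J₀ + J₁)² (P₀ + P₁ + P₃)² supported on the exponents ≡ 2.
  private
    main = (J₀ · P₁ ⊕ J₁ · P₀) · (J₀ · P₁ ⊕ J₁ · P₀) ⊕ # 2 · (J₀ · J₁) · (P₀ · P₁ ⊕ P₃ · P₃)

    -- The three brackets of `main` are, up to a unit, the left sides of `rotation-x`, `rotation-xz`
    -- and `rotation-1`. Both (M₀ M₁)² and M₁² · M₀² are the same product in q^5, which is why a
    -- multiple of F(q^5) comes out; the constant is 3² + 2 · 2 = 13 ≡ 3.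
    main≈ : main ≈[ N ] dilate 4 (m₁ · m₁ · (m₀ · m₀)) · (q^ 2 · # 3)
    main≈ = begin
      main
        ≈⟨ ⊕-cong (·-cong JP JP) (·-cong (·-congˡ JJ) PP) ⟩
      # 3 · A · (# 3 · A) ⊕ # 2 · (m₃ · m₃ ⊖ m₁ · m₁) · (m₀ · m₀ ⊖ # 2 · (m₀ · m₄) ⊕ m₂ · m₂)
        ≈⟨ ⊕-cong (solve 1 (λ x → con 3 :* x :* (con 3 :* x) := con 4 :* (x :* x)) ≈-refl A) ≈-refl ⟩
      # 4 · (A · A) ⊕ # 2 · (m₃ · m₃ ⊖ m₁ · m₁) · (m₀ · m₀ ⊖ # 2 · (m₀ · m₄) ⊕ m₂ · m₂)
        ≈⟨ ⊕-cong (·-congˡ (·-cong A≈ A≈)) (·-cong (·-congˡ B≈) C≈) ⟩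
      # 4 · (q^ 1 · (M₀ · M₁) · (q^ 1 · (M₀ · M₁))) ⊕ # 2 · (q^ 1 · (# 2 · (M₁ · M₁))) · (q^ 1 · (M₀ · M₀))
        ≈⟨ solve 3 (λ q a b → con 4 :* (q :* (a :* b) :* (q :* (a :* b))) :+ con 2 :* (q :* (con 2 :* (b :* b))) :* (q :* (a :* a))
             := b :* b :* (a :* a) :* (q :* q :* con 3)) ≈-refl (q^ 1) M₀ M₁ ⟩
      M₁ · M₁ · (M₀ · M₀) · (q^ 1 · q^ 1 · # 3)
        ≈⟨ ·-cong (≈-trans (dilate-· 4 _ _) (·-cong (dilate-· 4 m₁ m₁) (dilate-· 4 m₀ m₀))) (·-congʳ (q^-+ 1 1)) ⟨
      dilate 4 (m₁ · m₁ · (m₀ · m₀)) · (q^ 2 · # 3) ∎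
      where
      M₀ = dilate 4 m₀
      M₁ = dilate 4 m₁
      A = m₁ · m₄ ⊖ m₂ · m₃
      JP : J₀ · P₁ ⊕ J₁ · P₀ ≈[ N ] # 3 · A
      JP = solve 4 (λ b c d e → con 3 :* (b :+ d) :* (con 3 :* (e :- c)) :+ con 3 :* (b :- d) :* (con 3 :* (e :+ c))
        := con 3 :* (b :* e :- c :* d)) ≈-refl m₁ m₂ m₃ m₄
      JJ : J₀ · J₁ ≈[ N ] m₃ · m₃ ⊖ m₁ · m₁
      JJ = solve 2 (λ b d → con 3 :* (b :+ d) :* (con 3 :* (b :- d)) := d :* d :- b :* b) ≈-refl m₁ m₃
      PP : P₀ · P₁ ⊕ P₃ · P₃ ≈[ N ] m₀ · m₀ ⊖ # 2 · (m₀ · m₄) ⊕ m₂ · m₂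
      PP = solve 3 (λ a c e → con 3 :* (e :+ c) :* (con 3 :* (e :- c)) :+ (a :- e) :* (a :- e)
        := a :* a :- con 2 :* (a :* e) :+ c :* c) ≈-refl m₀ m₂ m₄
      A≈ : A ≈[ N ] q^ 1 · (M₀ · M₁)
      A≈ = ≈-trans (rotation-x N) (·-congˡ (dilate-· 4 m₀ m₁))
      B≈ : m₃ · m₃ ⊖ m₁ · m₁ ≈[ N ] q^ 1 · (# 2 · (M₁ · M₁))
      B≈ = ≈-trans (rotation-xz N) (·-congˡ (≈-trans (dilate-const-· 4 (+ 2) _) (·-congˡ (dilate-· 4 m₁ m₁))))
      C≈ : m₀ · m₀ ⊖ # 2 · (m₀ · m₄) ⊕ m₂ · m₂ ≈[ N ] q^ 1 · (M₀ · M₀)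
      C≈ = ≈-trans (rotation-1 N) (·-congˡ (dilate-· 4 m₀ m₀))

  -- Expanding (J₀ + J₁)² (P₀ + P₁ + P₃)² gives 18 kinds of products. Four have exponents ≡ 2 and
  -- form `main`; the fourteen in `rest` lie in other residue classes and are killed by U_2.
  section-theta⁴ : ∀ {N′} → N′ * 5 + 3 ≡ N → section 2 (m₁ · m₁ · (m₀ · m₀)) ≈[ suc N′ ] # 3 · (m₁ · m₁ · (m₀ · m₀))
  section-theta⁴ {N′} refl = R′.begin
    section 2 F
      R′.≈⟨ section-cong {N′} 2 F≈ ⟩
    section 2 (main ⊕ rest)
      R′.≈⟨ section-⊕ 2 main rest ⟩
    section 2 main ⊕ section 2 rest
      R′.≈⟨ ⊕-cong (section-cong {N′} 2 main≈) rest≈0 ⟩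
    section 2 (dilate 4 F · (q^ 2 · # 3)) ⊕ # 0
      R′.≈⟨ ≈-trans (⊕-identityʳ _) (section-dilate-· 2 (s≤s (s≤s (s≤s z≤n))) F (q^ 2 · # 3)) ⟩
    F · section 2 (q^ 2 · # 3)
      R′.≈⟨ ≈-trans (·-congˡ (section-q^·const 2 (+ 3))) (·-comm F (# 3)) ⟩
    # 3 · F R′.∎
    where
    module R′ = ≈-Reasoning (suc N′)
    F = m₁ · m₁ · (m₀ · m₀)
    term : PowerSeries → PowerSeries → PowerSeries → PowerSeries → PowerSeries
    term f g h k = f · g · (h · k)
    rest = term J₀ J₀ P₀ P₀ ⊕ # 2 · term J₀ J₀ P₀ P₁ ⊕ term J₀ J₀ P₃ P₃ ⊕ # 2 · term J₀ J₀ P₀ P₃ ⊕ # 2 · term J₀ J₀ P₁ P₃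
         ⊕ # 2 · term J₀ J₁ P₀ P₀ ⊕ # 4 · term J₀ J₁ P₀ P₃ ⊕ # 4 · term J₀ J₁ P₁ P₃ ⊕ # 2 · term J₀ J₁ P₁ P₁
         ⊕ # 2 · term J₁ J₁ P₀ P₁ ⊕ term J₁ J₁ P₁ P₁ ⊕ term J₁ J₁ P₃ P₃ ⊕ # 2 · term J₁ J₁ P₀ P₃ ⊕ # 2 · term J₁ J₁ P₁ P₃
    squares : main ≈[ N ] term J₀ J₀ P₁ P₁ ⊕ # 4 · term J₀ J₁ P₀ P₁ ⊕ term J₁ J₁ P₀ P₀ ⊕ # 2 · term J₀ J₁ P₃ P₃
    squares = solve 5 (λ J₀ J₁ P₀ P₁ K →
      (J₀ :* P₁ :+ J₁ :* P₀) :* (J₀ :* P₁ :+ J₁ :* P₀) :+ con 2 :* (J₀ :* J₁) :* (P₀ :* P₁ :+ K)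
      := J₀ :* J₀ :* (P₁ :* P₁) :+ con 4 :* (J₀ :* J₁ :* (P₀ :* P₁)) :+ J₁ :* J₁ :* (P₀ :* P₀) :+ con 2 :* (J₀ :* J₁ :* K))
      ≈-refl J₀ J₁ P₀ P₁ (P₃ · P₃)
    m₁² : m₁ · m₁ ≈[ N ] J₀ · J₀ ⊕ # 2 · (J₀ · J₁) ⊕ J₁ · J₁
    m₁² = ≈-trans (·-cong m₁≈J m₁≈J) (solve 2 (λ x y → (x :+ y) :* (x :+ y) := x :* x :+ con 2 :* (x :* y) :+ y :* y) ≈-refl J₀ J₁)
    m₀² : m₀ · m₀ ≈[ N ] P₀ · P₀ ⊕ # 2 · (P₀ · P₁) ⊕ P₁ · P₁ ⊕ # 2 · (P₀ · P₃) ⊕ # 2 · (P₁ · P₃) ⊕ P₃ · P₃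
    m₀² = ≈-trans (·-cong m₀≈P m₀≈P) (solve 3 (λ x y z → (x :+ y :+ z) :* (x :+ y :+ z)
      := x :* x :+ con 2 :* (x :* y) :+ y :* y :+ con 2 :* (x :* z) :+ con 2 :* (y :* z) :+ z :* z) ≈-refl P₀ P₁ P₃)
    F≈ : F ≈[ N ] main ⊕ rest
    F≈ = ≈-trans (·-cong m₁² m₀²) (≈-trans
      (solve 9 (λ a b c d e f g h k →
        (a :+ con 2 :* b :+ c) :* (d :+ con 2 :* e :+ f :+ con 2 :* g :+ con 2 :* h :+ k)
        := a :* f :+ con 4 :* (b :* e) :+ c :* d :+ con 2 :* (b :* k)
          :+ (a :* d :+ con 2 :* (a :* e) :+ a :* k :+ con 2 :* (a :* g) :+ con 2 :* (a :* h)
            :+ con 2 :* (b :* d) :+ con 4 :* (b :* g) :+ con 4 :* (b :* h) :+ con 2 :* (b :* f)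
            :+ con 2 :* (c :* e) :+ c :* f :+ c :* k :+ con 2 :* (c :* g) :+ con 2 :* (c :* h)))
        ≈-refl (J₀ · J₀) (J₀ · J₁) (J₁ · J₁) (P₀ · P₀) (P₀ · P₁) (P₁ · P₁) (P₀ · P₃) (P₁ · P₃) (P₃ · P₃))
      (⊕-cong (≈-sym squares) ≈-refl))
    Vanishing : PowerSeries → Set
    Vanishing f = section 2 f ≈[ suc N′ ] # 0
    infixl 6 _⊕₀_
    _⊕₀_ : ∀ {f g} → Vanishing f → Vanishing g → Vanishing (f ⊕ g)
    p ⊕₀ r = ≈-trans (section-⊕ 2 _ _) (≈-trans (⊕-cong p r) (⊕-identityˡ _))
    scaled : ∀ c {f} → Vanishing f → Vanishing (# c · f)
    scaled c p = ≈-trans (section-const-· 2 _ _) (≈-trans (·-congˡ p) (·-zeroʳ _))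
    -- Here `e` is an inverse of 2 - c modulo 5; that c differs from 2 modulo 5 is thus checked by
    -- computation.
    unsupported : ∀ {c f} e → Supported N c f → {_ : True (+ 5 ∣? (e ℤ.* (+ 2 ℤ.- + c) ℤ.- 1ℤ))} → Vanishing f
    unsupported {c} e p {d} = section-eigen 2 (+ c) e (mod5 (toWitness d)) p λ n n<N →
      subst (n * 5 + 2 <_) (≡.sym (ℕ.+-suc (N′ * 5) 2)) (s≤s (ℕ.+-monoˡ-≤ 2 (ℕ.*-monoˡ-≤ 5 (s≤s⁻¹ n<N))))
    support : ∀ {a b c d f g h k} → Supported N a f → Supported N b g → Supported N c h → Supported N d k →
      Supported N (a + b + (c + d)) (term f g h k)
    support p r s t = supported-· (supported-· p r) (supported-· s t)
    rest≈0 : Vanishing rest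
    rest≈0 = unsupported (+ 3) (support j₀ j₀ p₀ p₀) ⊕₀ scaled 2 (unsupported (+ 1) (support j₀ j₀ p₀ p₁))
      ⊕₀ unsupported (+ 1) (support j₀ j₀ p₃ p₃) ⊕₀ scaled 2 (unsupported (+ 4) (support j₀ j₀ p₀ p₃))
      ⊕₀ scaled 2 (unsupported (+ 2) (support j₀ j₀ p₁ p₃))
      ⊕₀ scaled 2 (unsupported (+ 1) (support j₀ j₁ p₀ p₀)) ⊕₀ scaled 4 (unsupported (+ 2) (support j₀ j₁ p₀ p₃))
      ⊕₀ scaled 4 (unsupported (+ 3) (support j₀ j₁ p₁ p₃)) ⊕₀ scaled 2 (unsupported (+ 4) (support j₀ j₁ p₁ p₁))
      ⊕₀ scaled 2 (unsupported (+ 4) (support j₁ j₁ p₀ p₁)) ⊕₀ unsupported (+ 2) (support j₁ j₁ p₁ p₁)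
      ⊕₀ unsupported (+ 4) (support j₁ j₁ p₃ p₃) ⊕₀ scaled 2 (unsupported (+ 3) (support j₁ j₁ p₀ p₃))
      ⊕₀ scaled 2 (unsupported (+ 1) (support j₁ j₁ p₁ p₃))
      where
      j₀ = J₀-supported
      j₁ = J₁-supported
      p₀ = P₀-supported
      p₁ = P₁-supported
      p₃ = P₃-supported

  section-theta² : ∀ {n} → n * 5 + 4 < N → section 4 (m₁ · dilate 1 m₁) ≈[ suc n ] # 0
  section-theta² {n} bound = ≈-trans (section-cong {n} 4 (weaken (subst (_≤ N) (≡.sym (ℕ.+-suc (n * 5) 4)) bound) expand))
    (unsupported (+ 4) (supported-· J₀-supported (supported-dilate J₀-supported))
      ⊕₀ unsupported (+ 2) (supported-· J₁-supported (supported-dilate J₀-supported))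
      ⊕₀ unsupported (+ 3) (supported-· J₀-supported (supported-dilate J₁-supported))
      ⊕₀ unsupported (+ 1) (supported-· J₁-supported (supported-dilate J₁-supported)))
    where
    expand : m₁ · dilate 1 m₁ ≈[ N ] J₀ · dilate 1 J₀ ⊕ J₁ · dilate 1 J₀ ⊕ J₀ · dilate 1 J₁ ⊕ J₁ · dilate 1 J₁
    expand = ≈-trans (·-cong m₁≈J (≈-trans (dilate-cong 1 m₁≈J) (dilate-⊕ 1 J₀ J₁)))
      (solve 4 (λ a b c d → (a :+ b) :* (c :+ d) := a :* c :+ b :* c :+ a :* d :+ b :* d) ≈-refl J₀ J₁ (dilate 1 J₀) (dilate 1 J₁))
    unsupported : ∀ {c f} e → Supported N c f → {_ : True (+ 5 ∣? (e ℤ.* (+ 4 ℤ.- + c) ℤ.- 1ℤ))} → section 4 f ≈[ suc n ] # 0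
    unsupported {c} e p {d} = section-eigen 4 (+ c) e (mod5 (toWitness d)) p λ n′ n′<n →
      ℕ.≤-<-trans (ℕ.+-monoˡ-≤ 4 (ℕ.*-monoˡ-≤ 5 (s≤s⁻¹ n′<n))) bound
    infixl 6 _⊕₀_
    _⊕₀_ : ∀ {f g} → section 4 f ≈[ suc n ] # 0 → section 4 g ≈[ suc n ] # 0 → section 4 (f ⊕ g) ≈[ suc n ] # 0
    p ⊕₀ r = ≈-trans (section-⊕ 4 _ _) (≈-trans (⊕-cong p r) (⊕-identityˡ _))

-- From theta series to a(25n + 22)

cubes²·²-regroup : ∀ {N} e m → e · e · e · (e · e · e) · (m · m) ≈[ N ] e · e · e · e · (e · m · (e · m))
cubes²·²-regroup {N} = solve 2 (λ e m → e :* e :* e :* (e :* e :* e) :* (m :* m) := e :* e :* e :* e :* (e :* m :* (e :* m))) ≈-refl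
  where open Solver N

^⁵·-regroup : ∀ {N} e f g → (e · f) ^⁵ · g ≈[ N ] e · e · e · e · (f · f · f · f) · (e · f · g)
^⁵·-regroup {N} = solve 3 (λ e f g → e :* f :* (e :* f) :* (e :* f) :* (e :* f) :* (e :* f) :* g
  := e :* e :* e :* e :* (f :* f :* f :* f) :* (e :* f :* g)) ≈-refl
  where open Solver N

section-cubic : ∀ N → section 2 (fromℕ (cubicSeries (N * 5 + 2))) ≈[ suc N ] # 3 · (moment (suc (N * 5 + 2)) 1 · dilate 1 (moment (suc (N * 5 + 2)) 1))
section-cubic N = begin
  section 2 A
    -- Division by E(q) E(q²) is multiplication by A: a factor E(q) E(q²) A = 1 is inserted, and its
    -- part E(q) E(q²) moves inside U_2 as E(q^5) E(q^10).
    ≈⟨ ≈-trans (·-congʳ (cubic-inverse M)) (·-identityˡ _) ⟨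
  e · e₂ · A · section 2 A
    ≈⟨ solve 4 (λ e e₂ a s → e :* e₂ :* a :* s := a :* (e :* e₂ :* s)) ≈-refl e e₂ A (section 2 A) ⟩
  A · (e · e₂ · section 2 A)
    ≈⟨ ·-congˡ (section-dilate-· 2 (s≤s (s≤s (s≤s z≤n))) (e · e₂) A) ⟨
  A · section 2 (dilate 4 (e · e₂) · A)
    ≈⟨ ·-congˡ (section-cong {N} 2 (subst (λ z → dilate 4 (e · e₂) · A ≈[ z ] F) 1+M≡ (≈-trans product≈ (≈-sym F≈)))) ⟩
  A · section 2 F
    ≈⟨ ·-congˡ (section-theta⁴ (suc M) (≡.sym 1+M≡)) ⟩
  A · (# 3 · F)
    ≈⟨ ·-congˡ (·-congˡ (weaken (s≤s (ℕ.≤-trans (ℕ.m≤m*n N 5) (ℕ.m≤m+n (N * 5) 2))) F≈)) ⟩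
  A · (# 3 · (e · e · e · e · (e₂ · e₂ · e₂ · e₂)))
    -- The remaining factor A cancels one of the four copies of E(q) E(q²), leaving the cubes of
    -- Jacobi's identity.
    ≈⟨ solve 3 (λ e e₂ a → a :* (con 3 :* (e :* e :* e :* e :* (e₂ :* e₂ :* e₂ :* e₂)))
         := con 3 :* (e :* e :* e :* (e₂ :* e₂ :* e₂)) :* (e :* e₂ :* a)) ≈-refl e e₂ A ⟩
  # 3 · (e · e · e · (e₂ · e₂ · e₂)) · (e · e₂ · A)
    ≈⟨ ≈-trans (·-congˡ (cubic-inverse M)) (≈-trans (·-comm _ (# 1)) (·-identityˡ _)) ⟩
  # 3 · (e · e · e · (e₂ · e₂ · e₂))
    ≈⟨ ·-congˡ (weaken (s≤s (ℕ.≤-trans (ℕ.m≤m*n N 5) (ℕ.m≤m+n (N * 5) 2))) (·-cong cube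
         (≈-trans (≈-sym (≈-trans (dilate-· 1 _ _) (·-congʳ (dilate-· 1 _ _)))) (dilate-cong 1 cube)))) ⟩
  # 3 · (m₁ · dilate 1 m₁) ∎
  where
  M = N * 5 + 2
  A = fromℕ (cubicSeries M)
  e = euler M
  e₂ = dilate 1 (euler M)
  m₀ = moment (suc M) 0
  m₁ = moment (suc M) 1
  F = m₁ · m₁ · (m₀ · m₀)
  open Solver (suc N)
  open ≈-Reasoning (suc N)
  1+M≡ : suc M ≡ N * 5 + 3
  1+M≡ = ≡.sym (ℕ.+-suc (N * 5) 2)
  cube : e · e · e ≈[ suc M ] m₁
  cube = ≈-trans (jacobi-cube M) (∑-cong (suc M) λ k _ → ·-congʳ (const-cong (∼-reflexive (≡.sym (ℤ.*-identityʳ (signedOdd k))))))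
  F≈ : F ≈[ suc M ] e · e · e · e · (e₂ · e₂ · e₂ · e₂)
  F≈ = ≈-trans (·-congʳ (·-cong (≈-sym cube) (≈-sym cube))) (≈-trans (cubes²·²-regroup e m₀)
    (≈-trans (·-congˡ (·-cong (gauss-triangular M) (gauss-triangular M))) (·-congˡ (≈-sym (·-assoc _ _ _)))))
  product≈ : dilate 4 (e · e₂) · A ≈[ suc M ] e · e · e · e · (e₂ · e₂ · e₂ · e₂)
  product≈ = ≈-trans (·-congʳ (≈-sym (frobenius (e · e₂)))) (≈-trans (^⁵·-regroup e e₂ A)
    (≈-trans (·-congˡ (cubic-inverse M)) (≈-trans (·-comm _ (# 1)) (·-identityˡ _))))

theorem1p3 : (n : ℕ) → 5 ∣ a (25 * n + 22)
theorem1p3 n = subst (λ m → 5 ∣ a m) (index n) (∣.∣⇒∣ᵤ (subst (+ 5 ∣.∣_) (ℤ.+-identityʳ (+ a ((n * 5 + 4) * 5 + 2))) (_∼_.difference vanish)))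
  where
  N = n * 5 + 4
  T = moment (suc (N * 5 + 2)) 1 · dilate 1 (moment (suc (N * 5 + 2)) 1)
  index : ∀ n → (n * 5 + 4) * 5 + 2 ≡ 25 * n + 22
  index = ℕ-Solver.solve-∀
  section≈0 : section 4 (section 2 (fromℕ (cubicSeries (N * 5 + 2)))) ≈[ suc n ] # 0
  section≈0 = ≈-trans (section-cong {n} 4 (weaken (ℕ.≤-reflexive (ℕ.+-suc (n * 5) 4)) (section-cubic N)))
    (≈-trans (section-const-· 4 (+ 3) T) (≈-trans (·-congˡ (section-theta² (suc (N * 5 + 2)) (s≤s (ℕ.≤-trans (ℕ.m≤m*n N 5) (ℕ.m≤m+n (N * 5) 2))))) (·-zeroʳ _)))
  -- The truncation index `N * 5 + 2` equals the index of the coefficient read off by the two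
  -- sections, so this coefficient is `a (N * 5 + 2)` by definition.
  vanish : + a (N * 5 + 2) ∼ 0ℤ
  vanish = ∼-trans (coeff section≈0 n ℕ.≤-refl) (∼-reflexive (0-coeff n))
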